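{- $gr^3_2(B_8)=13$.
   Context: $K_n$ is the complete graph of order $n$. The book $B_n:=K_2+nK_1$ (graph join) is the graph on $n+2$ vertices consisting of an edge $xy$ (the spine) together with $n$ further, pairwise non-adjacent vertices (the pages), each adjacent to both $x$ and $y$. A $t$-coloring of $K_p$ is a map $f:E(K_p)\to\{1,\dots,t\}$, not assumed surjective. A Gallai $t$-coloring is a $t$-coloring with no rainbow triangle, i.e. there are no three vertices $x,y,z$ such that $f(xy),f(xz),f(yz)$ are pairwise distinct. For $1\le s<t$ and a graph $G$, the weakened Gallai-Ramsey number $gr^t_s(G)$ is the least $p\in\mathbb{N}$ such that every Gallai $t$-coloring of $K_p$ contains a (not necessarily induced) subgraph isomorphic to $G$ whose edges use at most $s$ colors. -}

module Defs where

open import Data.Nat.Base using (ℕ; _≤_)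
open import Data.Fin.Base using (Fin)
open import Data.Fin.Subset using (Subset; _∈_; ∣_∣)
open import Data.Product.Base using (_×_; _,_; ∃; ∃-syntax)
open import Data.Sum.Base using (_⊎_; inj₁; inj₂)
open import Data.Unit.Base using (⊤; tt)
open import Function.Definitions using (Injective)
open import Relation.Binary.Core using (Rel)
open import Relation.Binary.Definitions using (Symmetric; Irreflexive)
open import Relation.Binary.PropositionalEquality.Core
  using (_≡_; _≢_; refl; sym; ≢-sym)
open import Relation.Nullary.Negation.Core using (¬_)
open import Level using (0ℓ)

record Graph : Set₁ where
  field
    Vertex   : Set
    _~_      : Rel Vertex 0ℓ
    ~-sym    : Symmetric _~_
    ~-irrefl : Irreflexive _≡_ _~_

K : ℕ → Graph
K n = record
  { Vertex   = Fin n
  ; _~_      = _≢_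
  ; ~-sym    = ≢-sym
  ; ~-irrefl = λ x≡y x≢y → x≢y x≡y
  }

infix 7 _·_
infixr 6 _∨_

-- n · G is the disjoint union of n copies of G.
_·_ : ℕ → Graph → Graph
n · G = record
  { Vertex   = Fin n × Vertex
  ; _~_      = λ (i , u) (j , v) → i ≡ j × u ~ v
  ; ~-sym    = λ (i≡j , u~v) → sym i≡j , ~-sym u~v
  ; ~-irrefl = λ { refl (_ , u~u) → ~-irrefl refl u~u }
  }
  where open Graph G

-- G ∨ H is the graph join.
_∨_ : Graph → Graph → Graph
G ∨ H = record
  { Vertex   = G.Vertex ⊎ H.Vertex
  ; _~_      = adj
  ; ~-sym    = λ {x} {y} → adj-sym x y
  ; ~-irrefl = λ {x} {y} → adj-irrefl x y
  }
  where
  module G = Graph G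
  module H = Graph H

  adj : Rel (G.Vertex ⊎ H.Vertex) 0ℓ
  adj (inj₁ u) (inj₁ v) = u G.~ v
  adj (inj₁ _) (inj₂ _) = ⊤
  adj (inj₂ _) (inj₁ _) = ⊤
  adj (inj₂ u) (inj₂ v) = u H.~ v

  adj-sym : ∀ x y → adj x y → adj y x
  adj-sym (inj₁ _) (inj₁ _) e = G.~-sym e
  adj-sym (inj₁ _) (inj₂ _) _ = tt
  adj-sym (inj₂ _) (inj₁ _) _ = tt
  adj-sym (inj₂ _) (inj₂ _) e = H.~-sym e

  adj-irrefl : ∀ x y → x ≡ y → ¬ adj x y
  adj-irrefl (inj₁ _) _ refl e = G.~-irrefl refl e
  adj-irrefl (inj₂ _) _ refl e = H.~-irrefl refl e

Book : ℕ → Graph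
Book n = K 2 ∨ n · K 1

-- A map from the edge set to Fin t. The adjacency proof is irrelevant, so the
-- colour depends only on the two endpoints, and by `symmetric` not on their
-- order; nothing is assigned to pairs that are not edges.
record Colouring (t : ℕ) (G : Graph) : Set where
  open Graph G
  field
    colour    : ∀ u v → .(u ~ v) → Fin t
    symmetric : ∀ u v (e : u ~ v) → colour u v e ≡ colour v u (~-sym e)

module _ {t : ℕ} {G : Graph} (f : Colouring t G) where
  open Graph G
  open Colouring f

  RainbowTriangle : Set
  RainbowTriangle =
    ∃[ x ] ∃[ y ] ∃[ z ] ∃ λ (xy : x ~ y) → ∃ λ (xz : x ~ z) → ∃ λ (yz : y ~ z) →
      colour x y xy ≢ colour x z xz ×
      colour x y xy ≢ colour y z yz ×
      colour x z xz ≢ colour y z yz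

  Gallai : Set
  Gallai = ¬ RainbowTriangle

-- A copy of G in H as a not necessarily induced subgraph.
record _↪_ (G H : Graph) : Set where
  private
    module G = Graph G
    module H = Graph H
  field
    vertex    : G.Vertex → H.Vertex
    injective : Injective _≡_ _≡_ vertex
    edge      : ∀ {u v} → u G.~ v → vertex u H.~ vertex v

-- The colours on the edges of the copy all lie in some set of at most s colours.
UsesAtMost : ∀ {t G H} → ℕ → Colouring t H → G ↪ H → Set
UsesAtMost {t} {G} s f φ =
  ∃ λ (S : Subset t) → ∣ S ∣ ≤ s ×
    (∀ u v (e : u ~ v) → colour (vertex u) (vertex v) (edge e) ∈ S)
  where
  open Graph G
  open Colouring f
  open _↪_ φ

Forces : (t s : ℕ) → Graph → ℕ → Set
Forces t s G p =
  (f : Colouring t (K p)) → Gallai f → ∃ λ (φ : G ↪ K p) → UsesAtMost s f φ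

IsLeast : (ℕ → Set) → ℕ → Set
IsLeast P p = P p × (∀ q → P q → p ≤ q)

-- gr t s G ≡ p, as a relation: the weakened Gallai–Ramsey number, intended for
-- 1 ≤ s < t, is defined as a least element, which need not be computed to be named.
gr[_,_]_≐_ : (t s : ℕ) → Graph → ℕ → Set
gr[ t , s ] G ≐ p = IsLeast (Forces t s G) p

{-# OPTIONS --safe #-}
module Submission where

-- Write U_κ(x, y) for the set of vertices sending κ to x or y. An edge xy of another
-- colour spans a book avoiding κ with p - 2 - |U_κ(x, y)| pages, so for p = 13 a
-- counterexample has |U_κ(x, y)| ≥ 4 for all such xy and κ. By Gallai's theorem the
-- vertices split into at least two parts with no edge of some colour k between them and
-- a single colour between any two of them. Since k-degrees of vertices in different
-- parts sum to at least 4, there are at most four parts, and counting rules out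
-- the 2-coloured K₄'s in which every vertex sees both colours. In all other cases
-- the vertex set is a join A ∪ B in a single colour q. If |A| ≤ 6, then A turns out to be
-- a single vertex; deleting it leaves 12 vertices whose degrees in the
-- colours other than q are at least 4, and there the same analysis gives a contradiction.
-- For the lower bound, C₅ and C₇ (each with its complement) are joined in a third colour.

open import Algebra.Properties.CommutativeMonoid.Sum as Sum using ()
open import Data.Bool.Base using (Bool; true; false; if_then_else_; _∧_; _∨_)
import Data.Bool.Properties as Bool
open import Data.Empty using (⊥; ⊥-elim)
open import Data.Fin.Base using (Fin; zero; suc; toℕ; punchIn; inject≤)
open import Data.Fin.Patterns using (0F; 1F; 2F; 3F; 4F)
open import Data.Fin.Permutation using (Permutation′; _⟨$⟩ʳ_; _∘ₚ_; transpose)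
open import Data.Fin.Properties
  using (_≟_; any?; all?; ¬∀⟶∃¬; injective⇒≤; suc-injective; 0≢1+n; punchIn-injective; punchInᵢ≢i;
         inject≤-injective)
open import Data.Fin.Subset using (Subset; inside; outside; _∈_; _∉_; ∣_∣; ∁; ⁅_⁆)
open import Data.Fin.Subset.Properties using (x∉p⇒x∈∁p; x∈⁅y⁆⇒x≡y)
open import Data.Nat.Base
  using (ℕ; zero; suc; _+_; _*_; _≤_; _<_; z≤n; s≤s; s≤s⁻¹; ∣_-_∣; _≡ᵇ_; _<ᵇ_)
open import Data.Nat.Properties
  using (≤-refl; ≤-trans; ≤-reflexive; _≤?_; <⇒≱; ≰⇒>; ≮⇒≥; n≢0⇒n>0; m≤m+n; m≤n+m;
         +-comm; +-assoc; +-suc; +-identityʳ; +-mono-≤; +-monoʳ-≤; +-monoˡ-≤; +-cancelˡ-≤;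
         *-monoʳ-≤; *-monoˡ-≤; +-0-commutativeMonoid; module ≤-Reasoning)
open import Data.Nat.Tactic.RingSolver using (solve-∀)
open import Data.Product.Base using (Σ; ∃; ∃₂; _×_; _,_; proj₁; proj₂)
open import Data.Sum.Base using (_⊎_; inj₁; inj₂)
open import Data.Vec.Base using (there; []; _∷_)
open import Function.Base using (_∘_; id; case_of_)
open import Function.Definitions using (Injective)
open import Level using (0ℓ)
open import Relation.Binary.PropositionalEquality
  using (_≡_; _≢_; refl; sym; trans; cong; cong₂; subst; subst₂; ≢-sym)
open import Relation.Nullary.Decidable
  using (Dec; yes; no; does; _×-dec_; _⊎-dec_; _→-dec_; ¬?; from-yes; decidable-stable;
         False; toWitnessFalse)
open import Relation.Nullary.Negation using (¬_; contradiction)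
open import Relation.Unary using (Pred; Decidable; U)
open import Relation.Unary.Properties using (_∪?_; _∩?_; ∁?; U?)

open import Defs hiding (_∨_)

open Sum +-0-commutativeMonoid
  using (sum; sum-remove; ∑-distrib-+; ∑-comm; ∑-permute; sum-cong-≗; sum-replicate-zero)

private
  variable
    m n : ℕ

-- Counting

indicator : {P : Set} → Dec P → ℕ
indicator P? = if does P? then 1 else 0

indicator-∪ : {P Q R : Set} (P? : Dec P) (Q? : Dec Q) (R? : Dec R) →
  (R → P ⊎ Q) → indicator R? ≤ indicator P? + indicator Q?
indicator-∪ _        _        (no _)  _ = z≤n
indicator-∪ (yes _)  _        (yes _) _ = s≤s z≤n
indicator-∪ (no _)   (yes _)  (yes _) _ = ≤-refl
indicator-∪ (no ¬p)  (no ¬q)  (yes r) h = case h r of λ where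
  (inj₁ p) → contradiction p ¬p
  (inj₂ q) → contradiction q ¬q

indicator-⊎ : {P Q R : Set} (P? : Dec P) (Q? : Dec Q) (R? : Dec R) →
  (P → ¬ Q) → (P → R) → (Q → R) → indicator P? + indicator Q? ≤ indicator R?
indicator-⊎ (no _)  (no _)  _       _ _ _ = z≤n
indicator-⊎ (yes p) (yes q) _       d _ _ = contradiction q (d p)
indicator-⊎ (yes p) (no _)  (yes _) _ _ _ = ≤-refl
indicator-⊎ (yes p) (no _)  (no ¬r) _ f _ = contradiction (f p) ¬r
indicator-⊎ (no _)  (yes _) (yes _) _ _ _ = ≤-refl
indicator-⊎ (no _)  (yes q) (no ¬r) _ _ g = contradiction (g q) ¬r

sum-mono-≤ : {f g : Fin n → ℕ} → (∀ i → f i ≤ g i) → sum f ≤ sum g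
sum-mono-≤ {zero}  _ = z≤n
sum-mono-≤ {suc n} h = +-mono-≤ (h zero) (sum-mono-≤ (h ∘ suc))

sum-ones : ∀ n → sum {n} (λ _ → 1) ≡ n
sum-ones zero    = refl
sum-ones (suc n) = cong suc (sum-ones n)

count : {P : Pred (Fin n) 0ℓ} → Decidable P → ℕ
count P? = sum λ x → indicator (P? x)

module _ {P Q R : Pred (Fin n) 0ℓ} (P? : Decidable P) (Q? : Decidable Q) (R? : Decidable R) where

  count-∪ : (∀ {x} → R x → P x ⊎ Q x) → count R? ≤ count P? + count Q?
  count-∪ h = ≤-trans (sum-mono-≤ λ x → indicator-∪ (P? x) (Q? x) (R? x) h)
                      (≤-reflexive (∑-distrib-+ (λ x → indicator (P? x)) _))

  count-⊎ : (∀ {x} → P x → ¬ Q x) → (∀ {x} → P x → R x) → (∀ {x} → Q x → R x) →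
            count P? + count Q? ≤ count R?
  count-⊎ d f g = ≤-trans (≤-reflexive (sym (∑-distrib-+ (λ x → indicator (P? x)) _)))
                          (sum-mono-≤ λ x → indicator-⊎ (P? x) (Q? x) (R? x) d f g)

module _ {P Q R S : Pred (Fin n) 0ℓ}
  (P? : Decidable P) (Q? : Decidable Q) (R? : Decidable R) (S? : Decidable S) where

  count-⊎₃ : (∀ {x} → P x → ¬ Q x) → (∀ {x} → P x → ¬ R x) → (∀ {x} → Q x → ¬ R x) →
             (∀ {x} → P x → S x) → (∀ {x} → Q x → S x) → (∀ {x} → R x → S x) →
             count P? + (count Q? + count R?) ≤ count S?
  count-⊎₃ pq pr qr p q r = begin
    count P? + (count Q? + count R?)  ≤⟨ +-monoʳ-≤ (count P?) (count-⊎ Q? R? (Q? ∪? R?) qr inj₁ inj₂) ⟩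
    count P? + count (Q? ∪? R?)       ≤⟨ count-⊎ P? (Q? ∪? R?) S?
                                           (λ { x (inj₁ y) → pq x y ; x (inj₂ y) → pr x y })
                                           p (λ { (inj₁ x) → q x ; (inj₂ x) → r x }) ⟩
    count S?                          ∎
    where open ≤-Reasoning

count-mono : {P Q : Pred (Fin n) 0ℓ} (P? : Decidable P) (Q? : Decidable Q) →
             (∀ {x} → P x → Q x) → count P? ≤ count Q?
count-mono P? Q? h = sum-mono-≤ λ x → indicator-mono (P? x) (Q? x) h
  where
  indicator-mono : {P Q : Set} (P? : Dec P) (Q? : Dec Q) → (P → Q) → indicator P? ≤ indicator Q?
  indicator-mono (no _)  _       _ = z≤n
  indicator-mono (yes p) (yes _) _ = ≤-refl
  indicator-mono (yes p) (no ¬q) h = contradiction (h p) ¬q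

count-singleton : (x : Fin n) → count (x ≟_) ≡ 1
count-singleton {suc n} zero    = cong suc (sum-replicate-zero n)
count-singleton {suc n} (suc x) = count-singleton x

count-fibres : (p : Fin n → Fin m) → sum (λ a → count λ x → p x ≟ a) ≡ n
count-fibres {n} p = trans (∑-comm (λ a x → indicator (p x ≟ a)))
  (trans (sum-cong-≗ λ x → count-singleton (p x)) (sum-ones n))

count-pair : {x y : Fin n} → x ≢ y → 2 ≤ count ((x ≟_) ∪? (y ≟_))
count-pair {x = x} {y} x≢y =
  subst (_≤ count ((x ≟_) ∪? (y ≟_))) (cong₂ _+_ (count-singleton x) (count-singleton y))
    (count-⊎ (x ≟_) (y ≟_) ((x ≟_) ∪? (y ≟_)) (λ { refl refl → x≢y refl }) inj₁ inj₂)

count-≥⇒injection : {P : Pred (Fin n) 0ℓ} (P? : Decidable P) → m ≤ count P? →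
  ∃ λ (g : Fin m → Fin n) → Injective _≡_ _≡_ g × (∀ a → P (g a))
count-≥⇒injection {m = zero} P? _ = (λ ()) , (λ { {()} }) , λ ()
count-≥⇒injection {suc n} {suc m} P? h with P? zero
... | no _   = let g , inj , p = count-≥⇒injection (P? ∘ suc) h in
               suc ∘ g , (inj ∘ suc-injective) , p
... | yes p₀ with count-≥⇒injection (P? ∘ suc) (s≤s⁻¹ h)
...   | g , inj , p = g′ , inj′ , λ { zero → p₀ ; (suc a) → p a }
  where
  g′ : Fin (suc m) → Fin (suc n)
  g′ zero    = zero
  g′ (suc a) = suc (g a)

  inj′ : Injective _≡_ _≡_ g′
  inj′ {zero}  {zero}  _  = refl
  inj′ {suc _} {suc _} eq = cong suc (inj (suc-injective eq))

injection⇒count-≥ : {P : Pred (Fin n) 0ℓ} (P? : Decidable P) (g : Fin m → Fin n) →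
  Injective _≡_ _≡_ g → (∀ a → P (g a)) → m ≤ count P?
injection⇒count-≥ {m = zero}  P? g inj p = z≤n
injection⇒count-≥ {m = suc m} P? g inj p = begin
  suc m                              ≡⟨ cong (_+ m) (count-singleton (g zero)) ⟨
  count (g zero ≟_) + m              ≤⟨ +-monoʳ-≤ (count (g zero ≟_)) (injection⇒count-≥ rest? (g ∘ suc)
                                          (suc-injective ∘ inj) λ a → p (suc a) , λ eq → 0≢1+n (inj eq)) ⟩
  count (g zero ≟_) + count rest?    ≤⟨ count-⊎ (g zero ≟_) rest? P? (λ eq (_ , neq) → neq eq)
                                          (λ { refl → p zero }) proj₁ ⟩
  count P?                           ∎
  where
  open ≤-Reasoning
  rest? = P? ∩? ∁? (g zero ≟_)

count-≥⇒inhabited : {P : Pred (Fin n) 0ℓ} (P? : Decidable P) → 1 ≤ count P? → ∃ P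
count-≥⇒inhabited P? h = let g , _ , p = count-≥⇒injection P? h in g zero , p zero

count-≥⇒pair : {P : Pred (Fin n) 0ℓ} (P? : Decidable P) → 2 ≤ count P? →
  ∃₂ λ x y → x ≢ y × P x × P y
count-≥⇒pair P? h = let g , inj , p = count-≥⇒injection P? h in
  g 0F , g 1F , (λ eq → 0≢1+n (inj eq)) , p 0F , p 1F

-- Coloured edges

third : ∀ {i j k : Fin 3} → i ≢ j → i ≢ k → j ≢ k → ∀ {c} → c ≢ i → c ≢ j → c ≡ k
third {i} {j} {k} i≢j i≢k j≢k {c} = from-yes
  (all? {n = 3} λ i → all? {n = 3} λ j → all? {n = 3} λ k → all? {n = 3} λ c →
    ¬? (i ≟ j) →-dec ¬? (i ≟ k) →-dec ¬? (j ≟ k) →-dec ¬? (c ≟ i) →-dec ¬? (c ≟ j) →-dec c ≟ k)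
  i j k c i≢j i≢k j≢k

others : ∀ (k : Fin 3) → ∃₂ λ i j → i ≢ j × i ≢ k × j ≢ k
others 0F = 1F , 2F , (λ ()) , (λ ()) , λ ()
others 1F = 0F , 2F , (λ ()) , (λ ()) , λ ()
others 2F = 0F , 1F , (λ ()) , (λ ()) , λ ()

private
  variable
    f : Colouring 3 (K n)
    α β γ k : Fin 3
    u v w x y z : Fin n

-- Bundling distinctness with the colour gives a decidable relation that fails on the diagonal, so
-- neighbours can be counted without side conditions.
record Edge (f : Colouring 3 (K n)) (α : Fin 3) (u v : Fin n) : Set where
  constructor edge
  field
    distinct : u ≢ v
    coloured : Colouring.colour f u v distinct ≡ α

open Edge

edge? : ∀ (f : Colouring 3 (K n)) α u v → Dec (Edge f α u v)
edge? f α u v with u ≟ v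
... | yes u≡v = no λ e → distinct e u≡v
... | no u≢v with Colouring.colour f u v u≢v ≟ α
...   | yes eq = yes (edge u≢v eq)
...   | no neq = no λ e → neq (coloured e)

edge-sym : Edge f α u v → Edge f α v u
edge-sym {f = f} (edge u≢v eq) = edge (≢-sym u≢v) (trans (sym (Colouring.symmetric f _ _ u≢v)) eq)

edge-unique : Edge f α u v → Edge f β u v → α ≡ β
edge-unique e e′ = trans (sym (coloured e)) (coloured e′)

edge-between : (f : Colouring 3 (K n)) → u ≢ v → ∃ λ α → Edge f α u v
edge-between f u≢v = _ , edge u≢v refl

no-rainbow : Gallai f → Edge f α x y → Edge f β x z → Edge f γ y z → α ≢ β → α ≢ γ → β ≡ γ
no-rainbow gf (edge d refl) (edge d′ refl) (edge d″ refl) α≢β α≢γ =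
  decidable-stable (_ ≟ _) λ β≢γ → gf (_ , _ , _ , d , d′ , d″ , α≢β , α≢γ , β≢γ)

restrict : (f : Colouring 3 (K n)) (g : Fin m → Fin n) → Injective _≡_ _≡_ g → Colouring 3 (K m)
restrict f g inj = record
  { colour    = λ u v u≢v → Colouring.colour f (g u) (g v) (λ eq → u≢v (inj eq))
  ; symmetric = λ u v u≢v → Colouring.symmetric f (g u) (g v) (λ eq → u≢v (inj eq))
  }

module _ {f : Colouring 3 (K n)} {g : Fin m → Fin n} {inj : Injective _≡_ _≡_ g} where

  restrict⁺ : Edge f α (g u) (g v) → Edge (restrict f g inj) α u v
  restrict⁺ (edge d eq) = edge (λ { refl → d refl }) eq

  restrict⁻ : Edge (restrict f g inj) α u v → Edge f α (g u) (g v)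
  restrict⁻ (edge d eq) = edge (λ gu≡gv → d (inj gu≡gv)) eq

  restrict-gallai : Gallai f → Gallai (restrict f g inj)
  restrict-gallai gf (x , y , z , xy , xz , yz , rest) =
    gf (g x , g y , g z , xy ∘ inj , xz ∘ inj , yz ∘ inj , rest)

-- Gallai partitions

-- `rep` witnesses that none of the `m` parts is empty, which bounds their number by `n`.
record Partition (f : Colouring 3 (K n)) (k : Fin 3) (m : ℕ) : Set where
  field
    part     : Fin n → Fin m
    rep      : Fin m → Fin n
    part-rep : ∀ a → part (rep a) ≡ a
    closed   : Edge f k x y → part x ≡ part y

open Partition

-- Only one end of the edge varies; using this at both ends in turn yields a single colour between
-- two parts.
Mono : Partition f k m → Set
Mono {f = f} P = ∀ {v y z α β} → part P y ≡ part P z → part P v ≢ part P y →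
  Edge f α v y → Edge f β v z → α ≡ β

rep-injective : (P : Partition f k m) → Injective _≡_ _≡_ (rep P)
rep-injective P eq = trans (sym (part-rep P _)) (trans (cong (part P) eq) (part-rep P _))

rep-distinct : (P : Partition f k m) {a b : Fin m} → a ≢ b → part P (rep P a) ≢ part P (rep P b)
rep-distinct P a≢b eq = a≢b (trans (sym (part-rep P _)) (trans eq (part-rep P _)))

cross-colour : (P : Partition f k m) → part P x ≢ part P y → Edge f α x y → α ≢ k
cross-colour P neq e refl = neq (closed P e)

cut : {S : Pred (Fin n) 0ℓ} → Decidable S → (∀ {x y} → Edge f k x y → S x → S y) →
      S u → ¬ S v → Partition f k 2
cut {f = f} {k = k} {u = u} {v = v} {S} S? closed-S Su ¬Sv = record
  { part = side ∘ S? ; rep = rep′ ; part-rep = side-rep ; closed = side-closed }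
  where
  side : {A : Set} → Dec A → Fin 2
  side (yes _) = 0F
  side (no _)  = 1F

  rep′ : Fin 2 → Fin _
  rep′ 0F = u
  rep′ 1F = v

  side-rep : ∀ a → side (S? (rep′ a)) ≡ a
  side-rep 0F with S? u
  ... | yes _  = refl
  ... | no ¬Su = contradiction Su ¬Su
  side-rep 1F with S? v
  ... | yes Sv = contradiction Sv ¬Sv
  ... | no _   = refl

  side-closed : ∀ {x y} → Edge f k x y → side (S? x) ≡ side (S? y)
  side-closed {x} {y} e with S? x | S? y
  ... | yes _  | yes _  = refl
  ... | no _   | no _   = refl
  ... | yes Sx | no ¬Sy = contradiction (closed-S e Sx) ¬Sy
  ... | no ¬Sx | yes Sy = contradiction (closed-S (edge-sym e) Sy) ¬Sx

-- A vertex v outside a part to which it sends both α and another colour splits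
-- that part: its α-neighbours and the rest are not joined by k, since otherwise
-- a rainbow triangle would appear.
split : {f : Colouring 3 (K n)} → Gallai f → (P : Partition f k m) →
  part P y ≡ part P z → part P v ≢ part P y → Edge f α v y → ¬ Edge f α v z →
  Partition f k (suc m)
split {n = n} {k = k} {m = m} {y = y} {z = z} {v = v} {α = α} {f = f} gf P yz vy e ¬e = record
  { part = λ u → new u (New? u) ; rep = rep′ ; part-rep = part-rep′ ; closed = λ {u} {w} → closed′ u w }
  where
  New : Pred (Fin n) 0ℓ
  New u = part P u ≡ part P y × Edge f α v u

  New? : Decidable New
  New? u = part P u ≟ part P y ×-dec edge? f α v u

  new : ∀ u → Dec (New u) → Fin (suc m)
  new u (yes _) = zero
  new u (no _)  = suc (part P u)

  rep′ : Fin (suc m) → Fin n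
  rep′ zero = y
  -- The old representative of this part may have moved to the new part, whereas `z` stays behind.
  rep′ (suc a) with a ≟ part P y
  ... | yes _ = z
  ... | no _  = rep P a

  part-rep′ : ∀ a → new (rep′ a) (New? (rep′ a)) ≡ a
  part-rep′ zero with New? y
  ... | yes _   = refl
  ... | no ¬new = contradiction (refl , e) ¬new
  part-rep′ (suc a) with a ≟ part P y
  ... | yes refl with New? z
  ...   | yes (_ , e′) = contradiction e′ ¬e
  ...   | no _         = cong suc (sym yz)
  part-rep′ (suc a) | no a≢y with New? (rep P a)
  ...   | yes (eq , _) = contradiction (trans (sym (part-rep P a)) eq) a≢y
  ...   | no _         = cong suc (part-rep P a)

  new-closed : ∀ {u w} → Edge f k u w → New u → New w
  new-closed {u} {w} uw (u∈ , vu) = w∈ , subst (λ c → Edge f c v w) (sym α≡β) (proj₂ vw)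
    where
    w∈ = trans (sym (closed P uw)) u∈
    v≢w = λ v≡w → vy (trans (cong (part P) v≡w) w∈)
    vw = edge-between f v≢w
    α≢k = cross-colour P (λ eq → vy (trans eq u∈)) vu
    β≢k = cross-colour P (λ eq → vy (trans eq w∈)) (proj₂ vw)
    α≡β = decidable-stable (α ≟ proj₁ vw) λ α≢β → β≢k (no-rainbow gf vu (proj₂ vw) uw α≢β α≢k)

  closed′ : ∀ u w → Edge f k u w → new u (New? u) ≡ new w (New? w)
  closed′ u w uw with New? u | New? w
  ... | yes _    | yes _   = refl
  ... | no _     | no _    = cong suc (closed P uw)
  ... | yes new  | no ¬new = contradiction (new-closed uw new) ¬new
  ... | no ¬new  | yes new = contradiction (new-closed (edge-sym uw) new) ¬new

mono-or-split : Gallai f → (P : Partition f k m) → Mono P ⊎ Partition f k (suc m)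
mono-or-split {f = f} gf P
  with any? (λ v → any? λ y → any? λ z → any? λ α →
    part P y ≟ part P z ×-dec ¬? (part P v ≟ part P y) ×-dec edge? f α v y ×-dec ¬? (edge? f α v z))
... | yes (v , y , z , α , yz , vy , e , ¬e) = inj₂ (split gf P yz vy e ¬e)
... | no ¬split = inj₁ λ {v} {y} {z} {α} {β} yz vy e e′ → decidable-stable (α ≟ β) λ α≢β →
  ¬split (v , y , z , α , yz , vy , e , λ e″ → α≢β (edge-unique e″ e′))

-- Each split adds a part, and representatives of different parts differ, so there are never more
-- than `n` parts; `d` bounds the splits still possible.
mono-refinement : {f : Colouring 3 (K n)} → Gallai f → ∀ d → n < 2 + m + d → Partition f k (2 + m) →
  ∃ λ m′ → Σ (Partition f k (2 + m′)) Mono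
mono-refinement {n} gf zero    n< P =
  contradiction (injective⇒≤ (rep-injective P)) (<⇒≱ (subst (n <_) (+-identityʳ _) n<))
mono-refinement {n} {m} gf (suc d) n< P with mono-or-split gf P
... | inj₁ mono = _ , P , mono
... | inj₂ P′   = mono-refinement gf d (subst (n <_) (cong (2 +_) (+-suc m d)) n<) P′

mono-partition : {f : Colouring 3 (K n)} → Gallai f → Partition f k 2 →
  ∃ λ m → Σ (Partition f k (2 + m)) Mono
mono-partition {n} gf = mono-refinement gf n (s≤s (+-monoˡ-≤ n z≤n))

another : (a : Fin (2 + m)) → ∃ (a ≢_)
another zero    = 1F , λ ()
another (suc _) = 0F , λ ()

-- If the new vertex v has a k-neighbour in every part, then it cannot have
-- neighbours in both other colours, so it is isolated in one of them.
extend-cut : {f : Colouring 3 (K (suc n))} → Gallai f →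
  (P : Partition (restrict f suc suc-injective) k (2 + m)) → Mono P → ∃ λ k′ → Partition f k′ 2
extend-cut {n} {k} {m} {f} gf P mono
  with all? (λ a → any? λ x → part P x ≟ a ×-dec edge? f k zero (suc x))
... | no ¬all = k , cut {S = S} S? S-closed (part-rep P a) id
  where
  missed = ¬∀⟶∃¬ _ _ (λ a → any? λ x → part P x ≟ a ×-dec edge? f k zero (suc x)) ¬all
  a = proj₁ missed

  -- Vertex zero sends no `k` to the part `a`, which therefore remains closed under `k` in the
  -- larger graph.
  S : Pred (Fin (suc n)) 0ℓ
  S zero    = ⊥
  S (suc x) = part P x ≡ a

  S? : Decidable S
  S? zero    = no id
  S? (suc x) = part P x ≟ a

  S-closed : ∀ {x y} → Edge f k x y → S x → S y
  S-closed {suc x} {zero}  e Sx = proj₂ missed (x , Sx , edge-sym e)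
  S-closed {suc x} {suc y} e Sx = trans (sym (closed P (restrict⁺ {inj = suc-injective} e))) Sx
... | yes all with others k
...   | i , j , i≢j , i≢k , j≢k with any? (edge? f i zero) | any? (edge? f j zero)
...     | no ¬i | _     = i , cut {v = suc (rep P 0F)} (zero ≟_) (λ { e refl → contradiction (_ , e) ¬i }) refl (λ ())
...     | yes _ | no ¬j = j , cut {v = suc (rep P 0F)} (zero ≟_) (λ { e refl → contradiction (_ , e) ¬j }) refl (λ ())
...     | yes (zero , e)  | yes _ = contradiction refl (distinct e)
...     | yes (suc _ , _) | yes (zero , e) = contradiction refl (distinct e)
...     | yes (suc y , vy) | yes (suc z , vz) = ⊥-elim rainbow
  where
  witness : (a : Fin (2 + m)) → Fin n
  witness a = proj₁ (all a)

  witness∈ : ∀ a → part P (witness a) ≡ a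
  witness∈ a = proj₁ (proj₂ (all a))

  -- In the triangle on zero, `y` and the witness, the edges at zero have the colours `c` and `k`.
  -- The third edge crosses between parts, so it is not `k` and must be `c`.
  forced : ∀ {c y a} → c ≢ k → Edge f c zero (suc y) → part P y ≢ a →
    Edge (restrict f suc suc-injective) c y (witness a)
  forced {c} {y} {a} c≢k vy y∉a = subst (λ c → Edge _ c y (witness a)) (sym c≡d) (proj₂ d,e)
    where
    y≁w : part P y ≢ part P (witness a)
    y≁w eq = y∉a (trans eq (witness∈ a))
    d,e = edge-between (restrict f suc suc-injective) (λ y≡w → y≁w (cong (part P) y≡w))
    c≡d = decidable-stable (c ≟ proj₁ d,e) λ c≢d → cross-colour P y≁w (proj₂ d,e)
      (sym (no-rainbow gf vy (proj₂ (proj₂ (all a))) (restrict⁻ {inj = suc-injective} (proj₂ d,e)) c≢k c≢d))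

  rainbow : ⊥
  rainbow with part P y ≟ part P z
  -- A witness in any other part sends `i` to `y` and `j` to `z`, against `Mono`.
  ... | yes y~z = i≢j (mono y~z (λ w~y → y∉b (trans (sym w~y) (witness∈ b)))
                    (edge-sym (forced i≢k vy y∉b)) (edge-sym (forced j≢k vz (λ z∈b → y∉b (trans y~z z∈b)))))
    where
    b = proj₁ (another (part P y))
    y∉b = proj₂ (another (part P y))
  -- Seen from `y`, the vertex `z` and the witness in its part look alike, so `yz` has colour `i`;
  -- the symmetric comparison gives it colour `j`.
  ... | no y≁z = i≢j (trans
      (mono (witness∈ _) (λ y~w → y≁z (trans y~w (witness∈ _))) (forced i≢k vy y≁z) (proj₂ yz))
      (sym (mono (witness∈ _) (λ z~w → y≁z (sym (trans z~w (witness∈ _))))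
        (forced j≢k vz (≢-sym y≁z)) (edge-sym (proj₂ yz)))))
    where
    yz = edge-between (restrict f suc suc-injective) (λ y≡z → y≁z (cong (part P) y≡z))

-- Induction on the number of vertices: a refined partition of the graph without vertex zero extends
-- to a cut, possibly for another colour, and the cut is refined again.
gallai-partition : ∀ n {f : Colouring 3 (K (2 + n))} → Gallai f →
  ∃₂ λ k m → Σ (Partition f k (2 + m)) Mono
gallai-partition n {f} gf = _ , mono-partition gf (proj₂ (gallai-cut n gf))
  where
  gallai-cut : ∀ n {f : Colouring 3 (K (2 + n))} → Gallai f → ∃ λ k → Partition f k 2
  -- Any colour other than that of the only edge separates the two vertices.
  gallai-cut zero {f} gf =
    let c = Colouring.colour f 0F 1F (λ ())
        i , _ , _ , i≢c , _ = others c
    in i , cut {f = f} {v = 1F} (0F ≟_)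
      (λ { {1F} _ () ; {0F} {0F} _ _ → refl ; {0F} {1F} e _ → contradiction (sym (coloured e)) i≢c })
      refl (λ ())
  gallai-cut (suc n) {f} gf =
    let _ , _ , P , mono = gallai-partition n (restrict-gallai {f = f} {g = suc} {inj = suc-injective} gf)
    in extend-cut gf P mono

-- The reduced colouring

record Join (f : Colouring 3 (K n)) (γ : Fin 3) : Set where
  field
    side     : Fin n → Bool
    base     : Bool → Fin n
    side-base : ∀ b → side (base b) ≡ b
    cross    : side x ≢ side y → Edge f γ x y

-- In part a the edges of the colour hue a that leave the part all go to π a.
record Quad (f : Colouring 3 (K n)) (k : Fin 3) : Set where
  field
    partition : Partition f k 4
    mono      : Mono partition
    π         : Permutation′ 4
    hue       : Fin 4 → Fin 3
    hue≢k     : ∀ a → hue a ≢ k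
    near      : Edge f (hue (part partition x)) x y →
                part partition y ≡ part partition x ⊎ part partition y ≡ π ⟨$⟩ʳ part partition x

data Structure (f : Colouring 3 (K n)) (k : Fin 3) : Set where
  join : Join f γ → Structure f k
  quad : Quad f k → Structure f k
  many : Partition f k (5 + m) → Structure f k

join-part : {f : Colouring 3 (K n)} (P : Partition f k (2 + m)) (a : Fin (2 + m)) →
  (∀ {x y} → part P x ≡ a → part P y ≢ a → Edge f γ x y) → Join f γ
join-part {n} {m = m} {γ = γ} {f = f} P a h = record
  { side = λ x → within (part P x ≟ a) ; base = base′ ; side-base = within-base
  ; cross = λ {x} {y} → within-cross x y }
  where
  within : {A : Set} → Dec A → Bool
  within (yes _) = true
  within (no _)  = false

  base′ : Bool → Fin n
  base′ true  = rep P a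
  base′ false = rep P (proj₁ (another a))

  within-base : ∀ b → within (part P (base′ b) ≟ a) ≡ b
  within-base true with part P (rep P a) ≟ a
  ... | yes _ = refl
  ... | no ¬a = contradiction (part-rep P a) ¬a
  within-base false with part P (rep P (proj₁ (another a))) ≟ a
  ... | yes b≡a = contradiction (sym (trans (sym (part-rep P _)) b≡a)) (proj₂ (another a))
  ... | no _    = refl

  within-cross : ∀ x y → within (part P x ≟ a) ≢ within (part P y ≟ a) → Edge f γ x y
  within-cross x y neq with part P x ≟ a | part P y ≟ a
  ... | yes _   | yes _   = contradiction refl neq
  ... | no _    | no _    = contradiction refl neq
  ... | yes x∈a | no y∉a  = h x∈a y∉a
  ... | no x∉a  | yes y∈a = edge-sym (h y∈a x∉a)

MonoVertex : (Fin m → Fin m → Fin 2) → Set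
MonoVertex {m} r = ∃₂ λ (a : Fin m) s → ∀ b → b ≢ a → r a b ≡ s

-- At each vertex some colour occurs on at most one edge, leading to `π a`. As `π` is a permutation,
-- the sizes of the parts `π a` again sum to the number of vertices.
Deranged : (Fin 4 → Fin 4 → Fin 2) → Permutation′ 4 → Set
Deranged r π = ∀ a → ∃ λ s → ∀ b → b ≢ a → r a b ≡ s → b ≡ π ⟨$⟩ʳ a

deranged? : ∀ r π → Dec (Deranged r π)
deranged? r π = all? λ a → any? λ s → all? λ b → ¬? (b ≟ a) →-dec r a b ≟ s →-dec b ≟ (π ⟨$⟩ʳ a)

monoVertex? : ∀ r → Dec (MonoVertex {m} r)
monoVertex? r = any? λ a → any? λ s → all? λ b → ¬? (b ≟ a) →-dec r a b ≟ s

-- If 0 and 1 both see two colours, then the edges 02 and 12 both differ from 01, so they agree and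
-- 2 sees only one.
mono-vertex₃ : (r : Fin 3 → Fin 3 → Fin 2) → (∀ a b → r a b ≡ r b a) → MonoVertex r
mono-vertex₃ r r-sym with r 0F 1F ≟ r 0F 2F | r 1F 0F ≟ r 1F 2F
... | yes p | _     = 0F , r 0F 1F , λ { 0F h → contradiction refl h ; 1F _ → refl ; 2F _ → sym p }
... | no _  | yes q = 1F , r 1F 0F , λ { 0F _ → refl ; 1F h → contradiction refl h ; 2F _ → sym q }
... | no ¬p | no ¬q = 2F , r 2F 0F , λ
  { 0F _ → refl
  ; 1F _ → pigeon {s = r 0F 1F} (λ eq → ¬q (trans (r-sym 1F 0F) (trans eq (r-sym 2F 1F))))
                                (λ eq → ¬p (trans eq (r-sym 2F 0F)))
  ; 2F h → contradiction refl h }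
  where
  pigeon : {s t u : Fin 2} → s ≢ t → s ≢ u → t ≡ u
  pigeon {0F} {0F}      p _ = contradiction refl p
  pigeon {0F} {1F} {0F} _ q = contradiction refl q
  pigeon {0F} {1F} {1F} _ _ = refl
  pigeon {1F} {1F}      p _ = contradiction refl p
  pigeon {1F} {0F} {1F} _ q = contradiction refl q
  pigeon {1F} {0F} {0F} _ _ = refl

-- Every permutation of four points has this form, so a search over triples `a`, `b`, `c` covers
-- them all.
perm : Fin 4 → Fin 4 → Fin 4 → Permutation′ 4
perm a b c = transpose 0F a ∘ₚ transpose 1F b ∘ₚ transpose 2F c

symmetric : (r₀₁ r₀₂ r₀₃ r₁₂ r₁₃ r₂₃ : Fin 2) → Fin 4 → Fin 4 → Fin 2
symmetric r₀₁ r₀₂ r₀₃ r₁₂ r₁₃ r₂₃ = λ where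
  0F 1F → r₀₁
  1F 0F → r₀₁
  0F 2F → r₀₂
  2F 0F → r₀₂
  0F 3F → r₀₃
  3F 0F → r₀₃
  1F 2F → r₁₂
  2F 1F → r₁₂
  1F 3F → r₁₃
  3F 1F → r₁₃
  2F 3F → r₂₃
  3F 2F → r₂₃
  -- Only the diagonal falls through to here, and `MonoVertex` and `Deranged` both skip it.
  _  _  → 0F

-- The remaining 2-colourings of K₄ are those whose colour classes are two paths, or
-- a 4-cycle and a perfect matching.
abstract
  classified : ∀ r₀₁ r₀₂ r₀₃ r₁₂ r₁₃ r₂₃ → let r = symmetric r₀₁ r₀₂ r₀₃ r₁₂ r₁₃ r₂₃ in
    MonoVertex r ⊎ ∃ λ a → ∃₂ λ b c → Deranged r (perm a b c)
  classified = from-yes (all? λ r₀₁ → all? λ r₀₂ → all? λ r₀₃ → all? λ r₁₂ → all? λ r₁₃ → all? λ r₂₃ →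
    let r = symmetric r₀₁ r₀₂ r₀₃ r₁₂ r₁₃ r₂₃ in
    monoVertex? r ⊎-dec any? λ a → any? λ b → any? λ c → deranged? r (perm a b c))

mono-vertex-or-deranged : (r : Fin 4 → Fin 4 → Fin 2) → (∀ a b → r a b ≡ r b a) →
  MonoVertex r ⊎ ∃ (Deranged r)
mono-vertex-or-deranged r r-sym =
  case classified (r 0F 1F) (r 0F 2F) (r 0F 3F) (r 1F 2F) (r 1F 3F) (r 2F 3F) of λ where
    (inj₁ (a , s , h)) → inj₁ (a , s , λ b b≢a → trans (agree a b (≢-sym b≢a)) (h b b≢a))
    (inj₂ (a , b , c , h)) → inj₂ (perm a b c , λ x → proj₁ (h x) , λ y y≢x eq →
      proj₂ (h x) y y≢x (trans (sym (agree x y (≢-sym y≢x))) eq))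
  where
  agree : ∀ a b → a ≢ b →
    r a b ≡ symmetric (r 0F 1F) (r 0F 2F) (r 0F 3F) (r 1F 2F) (r 1F 3F) (r 2F 3F) a b
  agree 0F 0F h = contradiction refl h
  agree 0F 1F _ = refl
  agree 0F 2F _ = refl
  agree 0F 3F _ = refl
  agree 1F 0F _ = r-sym 1F 0F
  agree 1F 1F h = contradiction refl h
  agree 1F 2F _ = refl
  agree 1F 3F _ = refl
  agree 2F 0F _ = r-sym 2F 0F
  agree 2F 1F _ = r-sym 2F 1F
  agree 2F 2F h = contradiction refl h
  agree 2F 3F _ = refl
  agree 3F 0F _ = r-sym 3F 0F
  agree 3F 1F _ = r-sym 3F 1F
  agree 3F 2F _ = r-sym 3F 2F
  agree 3F 3F h = contradiction refl h

module _ {f : Colouring 3 (K n)} {i j k : Fin 3} (i≢j : i ≢ j) (i≢k : i ≢ k) (j≢k : j ≢ k) where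

  hue₂ : Fin 2 → Fin 3
  hue₂ 0F = i
  hue₂ 1F = j

  hue₂≢k : ∀ s → hue₂ s ≢ k
  hue₂≢k 0F = i≢k
  hue₂≢k 1F = j≢k

  hue₂-injective : Injective _≡_ _≡_ hue₂
  hue₂-injective {0F} {0F} _  = refl
  hue₂-injective {0F} {1F} eq = contradiction eq i≢j
  hue₂-injective {1F} {0F} eq = contradiction (sym eq) i≢j
  hue₂-injective {1F} {1F} _  = refl

  module _ (P : Partition f k m) (mono : Mono P) where

    -- Between different parts "not `i`" means `j`, because `k` never crosses.
    reduced : Fin m → Fin m → Fin 2
    reduced a b = if does (edge? f i (rep P a) (rep P b)) then 0F else 1F

    edge-rep : part P x ≢ part P y → Edge f α x y → Edge f α x (rep P (part P y))
    edge-rep {x} {y} x≁y e = subst (λ c → Edge f c x _)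
      (sym (mono y~r x≁y e (proj₂ e′))) (proj₂ e′)
      where
      y~r = sym (part-rep P (part P y))
      e′ = edge-between f (λ x≡r → x≁y (trans (cong (part P) x≡r) (sym y~r)))

    edge-reps : part P x ≢ part P y → Edge f α x y → Edge f α (rep P (part P x)) (rep P (part P y))
    edge-reps x≁y e = edge-sym (edge-rep (λ r~x → x≁y (sym (trans (sym (part-rep P _)) r~x)))
      (edge-sym (edge-rep x≁y e)))

    reduced-colour : part P x ≢ part P y → Edge f α x y → α ≡ hue₂ (reduced (part P x) (part P y))
    reduced-colour {x} {y} x≁y e with edge? f i (rep P (part P x)) (rep P (part P y))
    ... | yes e′ = edge-unique (edge-reps x≁y e) e′
    ... | no ¬e′ = third i≢k i≢j (≢-sym j≢k)
                     (λ { refl → ¬e′ (edge-reps x≁y e) }) (cross-colour P x≁y e)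

    reduced-edge : part P x ≢ part P y → Edge f (hue₂ (reduced (part P x) (part P y))) x y
    reduced-edge {x} {y} x≁y =
      let c , e = edge-between f (λ x≡y → x≁y (cong (part P) x≡y)) in
      subst (λ c → Edge f c x y) (reduced-colour x≁y e) e

    reduced-sym : ∀ a b → reduced a b ≡ reduced b a
    reduced-sym a b with a ≟ b
    ... | yes refl = refl
    ... | no a≢b   = hue₂-injective (subst₂ (λ c d → hue₂ (reduced c d) ≡ hue₂ (reduced d c))
      (part-rep P a) (part-rep P b)
      (reduced-colour (λ eq → rep-distinct P a≢b (sym eq)) (edge-sym (reduced-edge (rep-distinct P a≢b)))))

  mono-vertex⇒join : (P : Partition f k (2 + m)) (mono : Mono P) →
    (v : MonoVertex (reduced P mono)) → Join f (hue₂ (proj₁ (proj₂ v)))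
  mono-vertex⇒join P mono (a , s , h) = join-part P a λ { {x} {y} refl y∉a →
    subst (λ c → Edge f (hue₂ c) x y) (h _ y∉a) (reduced-edge P mono (≢-sym y∉a)) }

  deranged⇒quad : (P : Partition f k 4) (mono : Mono P) → ∃ (Deranged (reduced P mono)) → Quad f k
  deranged⇒quad P mono (π , h) = record
    { partition = P ; mono = mono ; π = π
    ; hue = λ a → hue₂ (proj₁ (h a)) ; hue≢k = λ a → hue₂≢k (proj₁ (h a))
    ; near = near }
    where
    near : ∀ {x y} → Edge f (hue₂ (proj₁ (h (part P x)))) x y →
      part P y ≡ part P x ⊎ part P y ≡ π ⟨$⟩ʳ part P x
    near {x} {y} e with part P y ≟ part P x
    ... | yes eq = inj₁ eq
    ... | no neq = inj₂ (proj₂ (h (part P x)) _ neq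
      (hue₂-injective (sym (reduced-colour P mono (≢-sym neq) e))))

  partition-structure : (P : Partition f k (2 + m)) → Mono P → Structure f k
  partition-structure {0} P mono = join (mono-vertex⇒join P mono
    (0F , _ , λ { 0F h → contradiction refl h ; 1F _ → refl }))
  partition-structure {1} P mono =
    join (mono-vertex⇒join P mono (mono-vertex₃ _ (reduced-sym P mono)))
  partition-structure {2} P mono with mono-vertex-or-deranged _ (reduced-sym P mono)
  ... | inj₁ v = join (mono-vertex⇒join P mono v)
  ... | inj₂ d = quad (deranged⇒quad P mono d)
  partition-structure {suc (suc (suc _))} P mono = many P

structure : ∀ n {f : Colouring 3 (K (2 + n))} → Gallai f → ∃ (Structure f)
structure n gf =
  let k , _ , P , mono = gallai-partition n gf
      _ , _ , i≢j , i≢k , j≢k = others k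
  in k , partition-structure i≢j i≢k j≢k P mono

-- Degree counts

degree : Colouring 3 (K n) → Fin 3 → Fin n → ℕ
degree f α x = count (edge? f α x)

-- This is |U_κ(x, y)|, the size of the union of the two neighbourhoods and not of their
-- intersection.
codegree : Colouring 3 (K n) → Fin 3 → Fin n → Fin n → ℕ
codegree f α x y = count (edge? f α x ∪? edge? f α y)

Spread : ℕ → Colouring 3 (K n) → Fin 3 → Set
Spread s f κ = ∀ {x y α} → Edge f α x y → α ≢ κ → s ≤ codegree f κ x y

codegree≤ : ∀ (f : Colouring 3 (K n)) α x y → codegree f α x y ≤ degree f α x + degree f α y
codegree≤ f α x y = count-∪ (edge? f α x) (edge? f α y) (edge? f α x ∪? edge? f α y) id

star-bound : {f : Colouring 3 (K n)} {R : Pred (Fin n) 0ℓ} (R? : Decidable R) → α ≢ β → R x →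
  (∀ {y} → Edge f α x y → R y) → (∀ {y} → Edge f β x y → R y) →
  degree f α x + (degree f β x + 1) ≤ count R?
star-bound {α = α} {β} {x} {f} R? α≢β Rx hα hβ =
  subst (λ c → degree f α x + (degree f β x + c) ≤ count R?) (count-singleton x)
    (count-⊎₃ (edge? f α x) (edge? f β x) (x ≟_) R?
      (λ e e′ → α≢β (edge-unique e e′)) (λ e → distinct e) (λ e → distinct e) hα hβ (λ { refl → Rx }))

module _ {f : Colouring 3 (K n)} (P : Partition f k m) where

  fibre : Fin m → ℕ
  fibre a = count λ x → part P x ≟ a

  degree<fibre : ∀ x → degree f k x + 1 ≤ fibre (part P x)
  degree<fibre x = subst (λ c → degree f k x + c ≤ fibre (part P x)) (count-singleton x)
    (count-⊎ (edge? f k x) (x ≟_) (λ y → part P y ≟ part P x) (λ e → distinct e) (λ e → sym (closed P e)) (λ { refl → refl }))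

  degree-rep<fibre : ∀ a → degree f k (rep P a) + 1 ≤ fibre a
  degree-rep<fibre a = subst (λ b → degree f k (rep P a) + 1 ≤ fibre b) (part-rep P a)
    (degree<fibre (rep P a))

  -- The edge between two parts is not coloured `k`, so `Spread` for `k` applies to it.
  cross-degrees : ∀ {s} → Spread s f k → ∀ {x y} → part P x ≢ part P y →
    s ≤ degree f k x + degree f k y
  cross-degrees spread {x} {y} x≁y =
    let _ , e = edge-between f (λ x≡y → x≁y (cong (part P) x≡y)) in
    ≤-trans (spread e (cross-colour P x≁y e)) (codegree≤ f k x y)

sum-const : ∀ m c → sum {m} (λ _ → c) ≡ m * c
sum-const zero    c = refl
sum-const (suc m) c = cong (c +_) (sum-const m c)

-- Each part contains its representative together with all `k`-neighbours of it.
parts-bound : ∀ {f : Colouring 3 (K n)} {s} → Partition f k m → (∀ x → s ≤ degree f k x) → m * (s + 1) ≤ n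
parts-bound {n} {m = m} {s = s} P h = begin
  m * (s + 1)            ≡⟨ sum-const m (s + 1) ⟨
  sum {m} (λ _ → s + 1)  ≤⟨ sum-mono-≤ (λ a → ≤-trans (+-monoˡ-≤ 1 (h (rep P a))) (degree-rep<fibre P a)) ⟩
  sum (fibre P)          ≡⟨ count-fibres (part P) ⟩
  n                      ∎
  where open ≤-Reasoning

-- Five representatives are paired along a 5-cycle, so each `k`-degree is counted twice; a part has
-- at least one vertex more than the `k`-degree of its representative.
many-bound : ∀ {f : Colouring 3 (K n)} {s} → Partition f k (5 + m) → Spread s f k → 5 * s + 10 ≤ 2 * n
many-bound {n} {k} {f = f} {s} P spread = begin
  5 * s + 10
    ≡⟨ regroup₁ s ⟩
  s + (s + (s + (s + s))) + 10
    ≤⟨ +-monoˡ-≤ 10 (+-mono-≤ (pair 0F 1F λ ()) (+-mono-≤ (pair 1F 2F λ ())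
         (+-mono-≤ (pair 2F 3F λ ()) (+-mono-≤ (pair 3F 4F λ ()) (pair 4F 0F λ ()))))) ⟩
  (d 0F + d 1F) + ((d 1F + d 2F) + ((d 2F + d 3F) + ((d 3F + d 4F) + (d 4F + d 0F)))) + 10
    ≡⟨ regroup₂ (d 0F) (d 1F) (d 2F) (d 3F) (d 4F) ⟩
  2 * ((d 0F + 1) + ((d 1F + 1) + ((d 2F + 1) + ((d 3F + 1) + ((d 4F + 1) + 0)))))
    ≤⟨ *-monoʳ-≤ 2 (+-mono-≤ (part≤ 0F) (+-mono-≤ (part≤ 1F) (+-mono-≤ (part≤ 2F)
         (+-mono-≤ (part≤ 3F) (+-mono-≤ (part≤ 4F) z≤n))))) ⟩
  2 * sum (fibre P)
    ≡⟨ cong (2 *_) (count-fibres (part P)) ⟩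
  2 * n ∎
  where
  open ≤-Reasoning
  d = λ a → degree f k (rep P a)
  part≤ = degree-rep<fibre P

  pair : ∀ a b → a ≢ b → s ≤ d a + d b
  pair a b a≢b = cross-degrees P spread (rep-distinct P a≢b)

  regroup₁ : ∀ s → 5 * s + 10 ≡ s + (s + (s + (s + s))) + 10
  regroup₁ = solve-∀

  regroup₂ : ∀ a b c d e → (a + b) + ((b + c) + ((c + d) + ((d + e) + (e + a)))) + 10 ≡
    2 * ((a + 1) + ((b + 1) + ((c + 1) + ((d + 1) + ((e + 1) + 0)))))
  regroup₂ = solve-∀

module _ {f : Colouring 3 (K n)} (Q : Quad f k) where
  open Quad Q renaming (partition to P)

  hue-degree-bound : ∀ x →
    degree f (hue (part P x)) x + (degree f k x + 1) ≤ fibre P (part P x) + fibre P (π ⟨$⟩ʳ part P x)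
  hue-degree-bound x = ≤-trans
    (star-bound (own? ∪? next?) (hue≢k _) (inj₁ refl) near λ e → inj₁ (sym (closed P e)))
    (count-∪ own? next? (own? ∪? next?) id)
    where
    own? = λ y → part P y ≟ part P x
    next? = λ y → part P y ≟ π ⟨$⟩ʳ part P x

  sum-fibres-π : sum (λ a → fibre P (π ⟨$⟩ʳ a)) ≡ n
  sum-fibres-π = trans (sym (∑-permute (fibre P) π)) (count-fibres (part P))

  -- The parts are paired as 01 and 23. The representatives are arbitrary, so that both ends of a
  -- `k`-edge in each part can be used later.
  representative-degrees : ∀ {s} → Spread s f k → (r : Fin 4 → Fin n) → (∀ a → part P (r a) ≡ a) →
    2 * s ≤ sum (λ a → degree f k (r a))
  representative-degrees {s} spread r r∈ = begin
    2 * s                                ≡⟨ cong (s +_) (+-identityʳ s) ⟩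
    s + s                                ≤⟨ +-mono-≤ (pair 0F 1F λ ()) (pair 2F 3F λ ()) ⟩
    (d 0F + d 1F) + (d 2F + d 3F)        ≡⟨ regroup (d 0F) (d 1F) (d 2F) (d 3F) ⟩
    sum d                                ∎
    where
    open ≤-Reasoning
    d = λ a → degree f k (r a)

    pair : ∀ a b → a ≢ b → s ≤ d a + d b
    pair a b a≢b = cross-degrees P spread λ eq → a≢b (trans (sym (r∈ a)) (trans eq (r∈ b)))

    regroup : ∀ a b c d → (a + b) + (c + d) ≡ a + (b + (c + (d + 0)))
    regroup = solve-∀

  -- `hue-degree-bound` is summed over the four representatives; on the right every part is counted
  -- twice, once as `a` and once as `π a`.
  quad-bound : ∀ {s e} → Spread s f k → (∀ {α} x → α ≢ k → e ≤ degree f α x) →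
    4 * (e + 1) + 2 * s ≤ n + n
  quad-bound {s} {e} spread h = begin
    4 * (e + 1) + 2 * s
      ≤⟨ +-monoʳ-≤ (4 * (e + 1)) (representative-degrees spread (rep P) (part-rep P)) ⟩
    4 * (e + 1) + sum d
      ≡⟨ cong (_+ sum d) (sum-const 4 (e + 1)) ⟨
    sum {4} (λ _ → e + 1) + sum d
      ≡⟨ ∑-distrib-+ {4} (λ _ → e + 1) d ⟨
    sum (λ a → (e + 1) + d a)
      ≤⟨ sum-mono-≤ bound ⟩
    sum (λ a → fibre P a + fibre P (π ⟨$⟩ʳ a))
      ≡⟨ ∑-distrib-+ (fibre P) (λ a → fibre P (π ⟨$⟩ʳ a)) ⟩
    sum (fibre P) + sum (λ a → fibre P (π ⟨$⟩ʳ a))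
      ≡⟨ cong₂ _+_ (count-fibres (part P)) sum-fibres-π ⟩
    n + n ∎
    where
    open ≤-Reasoning
    d = λ a → degree f k (rep P a)

    regroup : ∀ e d → (e + 1) + d ≡ e + (d + 1)
    regroup = solve-∀

    bound : ∀ a → (e + 1) + d a ≤ fibre P a + fibre P (π ⟨$⟩ʳ a)
    bound a = begin
      (e + 1) + d a                                   ≡⟨ regroup e (d a) ⟩
      e + (d a + 1)                                   ≤⟨ +-monoˡ-≤ (d a + 1) (h (rep P a) (hue≢k _)) ⟩
      degree f (hue (part P (rep P a))) (rep P a) + (d a + 1)
                                                      ≤⟨ hue-degree-bound (rep P a) ⟩
      fibre P (part P (rep P a)) + fibre P (π ⟨$⟩ʳ part P (rep P a))
                                                      ≡⟨ cong (λ b → fibre P b + fibre P (π ⟨$⟩ʳ b)) (part-rep P a) ⟩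
      fibre P a + fibre P (π ⟨$⟩ʳ a)                  ∎

  -- For a k-edge xx′ inside a part a: the hue neighbours of x′ which are not hue neighbours
  -- of x stay in a, because outside a the vertices x and x′ look alike.
  hue-codegree-bound : ∀ {x x′} → Edge f k x x′ →
    codegree f (hue (part P x)) x x′ + (degree f k x + degree f k x′ + 2) ≤
    2 * fibre P (part P x) + fibre P (π ⟨$⟩ʳ part P x)
  hue-codegree-bound {x} {x′} xx′ = begin
    codegree f h x x′ + (degree f k x + degree f k x′ + 2)
      ≤⟨ +-monoˡ-≤ _ (count-∪ (edge? f h x) inner? (edge? f h x ∪? edge? f h x′) cover) ⟩
    degree f h x + count inner? + (degree f k x + degree f k x′ + 2)
      ≡⟨ regroup₁ (degree f h x) (count inner?) (degree f k x) (degree f k x′) ⟩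
    (degree f h x + (degree f k x + 1)) + (count inner? + (degree f k x′ + 1))
      ≤⟨ +-mono-≤ (hue-degree-bound x) inner≤ ⟩
    fibre P (part P x) + fibre P (π ⟨$⟩ʳ part P x) + fibre P (part P x)
      ≡⟨ regroup₂ (fibre P (part P x)) _ ⟩
    2 * fibre P (part P x) + fibre P (π ⟨$⟩ʳ part P x) ∎
    where
    open ≤-Reasoning
    h = hue (part P x)
    inner? = λ y → edge? f h x′ y ×-dec part P y ≟ part P x

    cover : ∀ {y} → Edge f h x y ⊎ Edge f h x′ y → Edge f h x y ⊎ (Edge f h x′ y × part P y ≡ part P x)
    cover (inj₁ e) = inj₁ e
    cover {y} (inj₂ e) with part P y ≟ part P x
    ... | yes y∈ = inj₂ (e , y∈)
    ... | no y∉  =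
      let c , e′ = edge-between f (λ x≡y → y∉ (cong (part P) (sym x≡y)))
      in inj₁ (subst (λ c → Edge f c x y)
           (mono (closed P xx′) y∉ (edge-sym e′) (edge-sym e)) e′)

    inner≤ : count inner? + (degree f k x′ + 1) ≤ fibre P (part P x)
    inner≤ = subst (λ c → count inner? + (degree f k x′ + c) ≤ fibre P (part P x)) (count-singleton x′)
      (count-⊎₃ inner? (edge? f k x′) (x′ ≟_) (λ y → part P y ≟ part P x)
        (λ (e , _) e′ → hue≢k _ (edge-unique e e′)) (λ (e , _) → distinct e) (λ e → distinct e)
        proj₂ (λ e → trans (sym (closed P e)) (sym (closed P xx′))) λ { refl → sym (closed P xx′) })

    regroup₁ : ∀ a b c d → a + b + (c + d + 2) ≡ (a + (c + 1)) + (b + (d + 1))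
    regroup₁ = solve-∀

    regroup₂ : ∀ a b → a + b + a ≡ 2 * a + b
    regroup₂ = solve-∀

-- The graph of a join

-- Edges of colours other than `γ` cannot leave the side of `x`.
join-degree-bound : {f : Colouring 3 (K n)} (J : Join f γ) → α ≢ γ → β ≢ γ → α ≢ β → ∀ b {x} →
  Join.side J x ≡ b → degree f α x + (degree f β x + 1) ≤ count (λ y → Join.side J y Bool.≟ b)
join-degree-bound {γ = γ} {f = f} J α≢γ β≢γ α≢β b {x} refl =
  star-bound (λ y → side y Bool.≟ b) α≢β refl (same α≢γ) (same β≢γ)
  where
  open Join J
  same : ∀ {c y} → c ≢ γ → Edge f c x y → side y ≡ side x
  same {y = y} c≢γ e = decidable-stable (side y Bool.≟ side x) λ neq →
    c≢γ (edge-unique e (cross (≢-sym neq)))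

sides-bound : {f : Colouring 3 (K n)} (J : Join f γ) →
  count (λ y → Join.side J y Bool.≟ true) + count (λ y → Join.side J y Bool.≟ false) ≤ n
sides-bound {n} J = ≤-trans
  (count-⊎ (λ y → side y Bool.≟ true) (λ y → side y Bool.≟ false) U?
    (λ p q → case trans (sym p) q of λ ()) (λ _ → _) (λ _ → _))
  (≤-reflexive (sum-ones n))
  where open Join J

-- One vertex is taken from each side. Their `α`- and `β`-neighbourhoods stay on their own sides,
-- and the edge between them has colour `γ`, so `hβ` applies to it.
join-bound : ∀ {f : Colouring 3 (K n)} {e s} (J : Join f γ) → α ≢ γ → β ≢ γ → α ≢ β → (∀ x → e ≤ degree f α x) →
  (∀ {x y} → Edge f γ x y → s ≤ degree f β x + degree f β y) → (e + e) + (s + 2) ≤ n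
join-bound {n} {γ = γ} {α = α} {β = β} {f = f} {e} {s} J α≢γ β≢γ α≢β hα hβ = begin
  (e + e) + (s + 2)
    ≤⟨ +-mono-≤ (+-mono-≤ (hα p) (hα r)) (+-monoˡ-≤ 2 (hβ pr)) ⟩
  (degree f α p + degree f α r) + (degree f β p + degree f β r + 2)
    ≡⟨ regroup (degree f α p) (degree f α r) (degree f β p) (degree f β r) ⟩
  (degree f α p + (degree f β p + 1)) + (degree f α r + (degree f β r + 1))
    ≤⟨ +-mono-≤ (join-degree-bound J α≢γ β≢γ α≢β true (side-base true))
                (join-degree-bound J α≢γ β≢γ α≢β false (side-base false)) ⟩
  count (λ y → side y Bool.≟ true) + count (λ y → side y Bool.≟ false)
    ≤⟨ sides-bound J ⟩
  n ∎
  where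
  open ≤-Reasoning
  open Join J
  p = base true
  r = base false
  pr = cross λ eq → case trans (sym (side-base true)) (trans eq (side-base false)) of λ ()

  regroup : ∀ a b c d → (a + b) + (c + d + 2) ≡ (a + (c + 1)) + (b + (d + 1))
  regroup = solve-∀

-- For numerals `a` and `c` the `False` argument is settled by computation; `a` and `c` display the
-- two counts that clash.
impossible : ∀ {a b c} → {False (a ≤? c)} → a ≤ b → b ≤ c → ⊥
impossible {c = c} {t} p q = toWitnessFalse t (≤-trans p q)

-- Twelve vertices

-- These hypotheses are what remains after deleting a vertex joined to all others in colour `q`: it
-- lies in every U_q(x, y), hence 3 in place of 4.
module _ {f : Colouring 3 (K (2 + n))} (n≤10 : n ≤ 10) (gf : Gallai f) {i j q : Fin 3}
  (i≢j : i ≢ j) (i≢q : i ≢ q) (j≢q : j ≢ q)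
  (dᵢ : ∀ x → 4 ≤ degree f i x) (dⱼ : ∀ x → 4 ≤ degree f j x) (spread : Spread 3 f q) where

  private
    ≤12 : 2 + n ≤ 12
    ≤12 = s≤s (s≤s n≤10)

    few-parts : (∀ x → 4 ≤ degree f k x) → Partition f k (4 + m) → ⊥
    few-parts {m = m} d P = impossible {20} {c = 12} (*-monoˡ-≤ 5 (m≤m+n 4 m)) (≤-trans (parts-bound P d) ≤12)

    spread-degrees : γ ≢ q → ∀ {x y} → Edge f γ x y → 3 ≤ degree f q x + degree f q y
    spread-degrees γ≢q {x} {y} e = ≤-trans (spread e γ≢q) (codegree≤ f q x y)

    no-join : Join f γ → ⊥
    no-join {γ} J with γ ≟ i | γ ≟ j
    -- 4 + 4 from the degrees in `j`, 3 from the degrees in `q` at the ends of an edge of the join,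
    -- and 2 for these ends.
    ... | yes refl | _ = impossible {13} {c = 12}
      (join-bound J (≢-sym i≢j) (≢-sym i≢q) j≢q dⱼ (spread-degrees i≢q)) ≤12
    ... | no _ | yes refl = impossible {13} {c = 12}
      (join-bound J i≢j (≢-sym j≢q) i≢q dᵢ (spread-degrees j≢q)) ≤12
    ... | no γ≢i | no γ≢j with third i≢j i≢q j≢q γ≢i γ≢j
    -- Both remaining colours have degrees at least 4, so `s` is 8 and the total is 8 + 8 + 2.
    ...   | refl = impossible {18} {c = 12}
      (join-bound J i≢q j≢q i≢j dᵢ (λ {x} {y} _ → +-mono-≤ (dⱼ x) (dⱼ y))) ≤12

    large : k ≢ q → ∀ x → 4 ≤ degree f k x
    large {k} k≢q x with k ≟ i
    ... | yes refl = dᵢ x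
    ... | no k≢i with third i≢q i≢j (≢-sym j≢q) k≢i k≢q
    ...   | refl = dⱼ x

    excluded : Structure f k → ⊥
    excluded {k} s with k ≟ q
    excluded (join J) | _ = no-join J
    -- The counts are 4 · 5 + 2 · 3 = 26 and 5 · 3 + 10 = 25, against 2 · 12. For `k` other than `q`
    -- all `k`-degrees are at least 4, so four parts already need 20 vertices.
    excluded (quad Q) | yes refl = impossible {26} {c = 24} (quad-bound Q spread (λ x α≢q → large α≢q x)) (+-mono-≤ ≤12 ≤12)
    excluded (many P) | yes refl = impossible {25} {c = 24} (many-bound P spread) (*-monoʳ-≤ 2 ≤12)
    excluded (quad Q) | no k≢q = few-parts (large k≢q) (Quad.partition Q)
    excluded (many P) | no k≢q = few-parts (large k≢q) P

  no-spread-colouring₁₂ : ⊥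
  no-spread-colouring₁₂ = excluded (proj₂ (structure n gf))

-- Thirteen vertices

module _ {f : Colouring 3 (K n)} (n≤13 : n ≤ 13) (spread : ∀ κ → Spread 4 f κ) where

  -- Every part contains a `k`-edge. Summing `hue-codegree-bound` over four such edges gives at
  -- least 4 · (4 + 2) + 8 + 8 = 40 on the left, and 3n on the right.
  no-quad : Quad f k → ⊥
  no-quad {k} Q = impossible {40} {c = 39} sum≥ (*-monoʳ-≤ 3 n≤13)
    where
    open Quad Q renaming (partition to P)
    open ≤-Reasoning

    -- If a representative has no `k`-neighbour, the other three have `k`-degree at least 4, and
    -- their parts have at least 5 vertices each.
    isolated-part : ∀ a → degree f k (rep P a) ≡ 0 → ⊥
    isolated-part a d≡0 = impossible {15} {c = 13} others≥ n≤13
      where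
      others≥ : 15 ≤ n
      others≥ = begin
        15                                       ≡⟨ sum-const 3 5 ⟨
        sum {3} (λ _ → 5)                        ≤⟨ sum-mono-≤ part≥ ⟩
        sum (λ b → fibre P (punchIn a b))        ≤⟨ m≤n+m _ (fibre P a) ⟩
        fibre P a + sum (λ b → fibre P (punchIn a b)) ≡⟨ sum-remove {i = a} (fibre P) ⟨
        sum (fibre P)                            ≡⟨ count-fibres (part P) ⟩
        n                                        ∎
        where
        part≥ : ∀ b → 5 ≤ fibre P (punchIn a b)
        part≥ b = ≤-trans
          (+-monoˡ-≤ 1 (subst (λ d → 4 ≤ d + degree f k (rep P (punchIn a b))) d≡0
            (cross-degrees P (spread k) (rep-distinct P (≢-sym (punchInᵢ≢i a b))))))
          (degree-rep<fibre P (punchIn a b))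

    neighbour : ∀ a → ∃ (Edge f k (rep P a))
    neighbour a = count-≥⇒inhabited (edge? f k (rep P a)) (n≢0⇒n>0 (isolated-part a))

    r r′ : Fin 4 → Fin n
    r a = rep P a
    r′ a = proj₁ (neighbour a)

    r′∈ : ∀ a → part P (r′ a) ≡ a
    r′∈ a = trans (sym (closed P (proj₂ (neighbour a)))) (part-rep P a)

    d d′ : Fin 4 → ℕ
    d a = degree f k (r a)
    d′ a = degree f k (r′ a)

    bound : ∀ a → 6 + (d a + d′ a) ≤ 2 * fibre P a + fibre P (π ⟨$⟩ʳ a)
    bound a = begin
      6 + (d a + d′ a)         ≡⟨ cong (4 +_) (+-comm 2 (d a + d′ a)) ⟩
      4 + (d a + d′ a + 2)     ≤⟨ +-monoˡ-≤ _ (spread _ (proj₂ (neighbour a)) (≢-sym (hue≢k _))) ⟩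
      codegree f (hue (part P (r a))) (r a) (r′ a) + (d a + d′ a + 2)
                               ≤⟨ hue-codegree-bound Q (proj₂ (neighbour a)) ⟩
      2 * fibre P (part P (r a)) + fibre P (π ⟨$⟩ʳ part P (r a))
                               ≡⟨ cong (λ b → 2 * fibre P b + fibre P (π ⟨$⟩ʳ b)) (part-rep P a) ⟩
      2 * fibre P a + fibre P (π ⟨$⟩ʳ a) ∎

    sum≥ : 40 ≤ 3 * n
    sum≥ = begin
      24 + (8 + 8)
        ≤⟨ +-monoʳ-≤ 24 (+-mono-≤ (representative-degrees Q (spread k) r (part-rep P))
                                  (representative-degrees Q (spread k) r′ r′∈)) ⟩
      24 + (sum d + sum d′)
        ≡⟨ cong (24 +_) (∑-distrib-+ d d′) ⟨
      sum {4} (λ _ → 6) + sum (λ a → d a + d′ a)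
        ≡⟨ ∑-distrib-+ {4} (λ _ → 6) (λ a → d a + d′ a) ⟨
      sum (λ a → 6 + (d a + d′ a))
        ≤⟨ sum-mono-≤ bound ⟩
      sum (λ a → 2 * fibre P a + fibre P (π ⟨$⟩ʳ a))
        ≡⟨ ∑-distrib-+ (λ a → 2 * fibre P a) (λ a → fibre P (π ⟨$⟩ʳ a)) ⟩
      sum (λ a → 2 * fibre P a) + sum (λ a → fibre P (π ⟨$⟩ʳ a))
        ≡⟨ cong₂ _+_ (trans (sum-double (fibre P)) (cong (2 *_) (count-fibres (part P)))) (sum-fibres-π Q) ⟩
      2 * n + n
        ≡⟨ +-comm (2 * n) n ⟩
      3 * n ∎
      where
      sum-double : (g : Fin 4 → ℕ) → sum (λ a → 2 * g a) ≡ 2 * sum g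
      sum-double g = begin-equality
        sum (λ a → 2 * g a)          ≡⟨ sum-cong-≗ (λ a → cong (g a +_) (+-identityʳ (g a))) ⟩
        sum (λ a → g a + g a)        ≡⟨ ∑-distrib-+ g g ⟩
        sum g + sum g                ≡⟨ cong (sum g +_) (+-identityʳ (sum g)) ⟨
        2 * sum g                    ∎

  -- Two vertices on a side of size at most six would force it to be a K₆ 2-coloured
  -- without monochromatic triangles, contrary to R(3, 3) = 6.
  module _ {γ} (J : Join f γ) (gf : Gallai f) (b : Bool)
    (small : count (λ y → Join.side J y Bool.≟ b) ≤ 6) where
    open Join J

    private
      S? : Decidable (λ y → side y ≡ b)
      S? y = side y Bool.≟ b

      stays : α ≢ γ → side x ≡ b → Edge f α x y → side y ≡ b
      stays {x = x} {y} α≢γ refl e = decidable-stable (side y Bool.≟ side x) λ neq →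
        α≢γ (edge-unique e (cross (≢-sym neq)))

      pair? = λ (x y : Fin n) → (x ≟_) ∪? (y ≟_)

      codegree-disjoint : Edge f α x y → β ≢ α → ∀ {z} → Edge f β x z ⊎ Edge f β y z → ¬ (x ≡ z ⊎ y ≡ z)
      codegree-disjoint e β≢α (inj₁ e′) (inj₁ refl) = distinct e′ refl
      codegree-disjoint e β≢α (inj₁ e′) (inj₂ refl) = β≢α (edge-unique e′ e)
      codegree-disjoint e β≢α (inj₂ e′) (inj₁ refl) = β≢α (edge-unique e′ (edge-sym e))
      codegree-disjoint e β≢α (inj₂ e′) (inj₂ refl) = distinct e′ refl

      codegree-stays : β ≢ γ → side x ≡ b → side y ≡ b → ∀ {z} → Edge f β x z ⊎ Edge f β y z → side z ≡ b
      codegree-stays β≢γ Sx Sy (inj₁ e) = stays β≢γ Sx e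
      codegree-stays β≢γ Sx Sy (inj₂ e) = stays β≢γ Sy e

      pair-stays : side x ≡ b → side y ≡ b → ∀ {z} → x ≡ z ⊎ y ≡ z → side z ≡ b
      pair-stays Sx Sy (inj₁ refl) = Sx
      pair-stays Sx Sy (inj₂ refl) = Sy

      -- Otherwise U_β(x, y), the pair `x`, `y` and `z` would be 4 + 2 + 1 vertices on the side.
      dominated : α ≢ γ → β ≢ γ → α ≢ β → side x ≡ b → side y ≡ b → side z ≡ b →
        x ≢ z → y ≢ z → Edge f α x y → Edge f β x z ⊎ Edge f β y z
      dominated {α} {β} {x} {y} {z} α≢γ β≢γ α≢β Sx Sy Sz x≢z y≢z e =
        decidable-stable (edge? f β x z ⊎-dec edge? f β y z) λ ¬e →
          impossible {7} {c = 6}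
            (≤-trans (+-mono-≤ (spread β e α≢β) (+-mono-≤ (count-pair (distinct e))
              (≤-reflexive (sym (count-singleton z)))))
              (count-⊎₃ (edge? f β x ∪? edge? f β y) (pair? x y) (z ≟_) S?
                (codegree-disjoint e (≢-sym α≢β)) (λ { e′ refl → ¬e e′ })
                (λ { (inj₁ x≡w) refl → x≢z x≡w ; (inj₂ y≡w) refl → y≢z y≡w })
                (codegree-stays β≢γ Sx Sy) (pair-stays Sx Sy) (λ { refl → Sz })))
            small

      -- For a `γ`-edge inside the side, U_α(x, y) and U_β(x, y) are disjoint, a mixed vertex giving
      -- a rainbow triangle; with `x` and `y` they fill 4 + 4 + 2 places.
      no-joining-edge : α ≢ γ → β ≢ γ → α ≢ β → side x ≡ b → side y ≡ b → ¬ Edge f γ x y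
      no-joining-edge {α} {β} {x} {y} α≢γ β≢γ α≢β Sx Sy e = impossible {10} {c = 6}
        (≤-trans (+-mono-≤ (spread α e (≢-sym α≢γ)) (+-mono-≤ (spread β e (≢-sym β≢γ)) (count-pair (distinct e))))
          (count-⊎₃ (edge? f α x ∪? edge? f α y) (edge? f β x ∪? edge? f β y) (pair? x y) S?
            disjoint (codegree-disjoint e α≢γ) (codegree-disjoint e β≢γ)
            (codegree-stays α≢γ Sx Sy) (codegree-stays β≢γ Sx Sy) (pair-stays Sx Sy)))
        small
        where
        disjoint : ∀ {z} → Edge f α x z ⊎ Edge f α y z → ¬ (Edge f β x z ⊎ Edge f β y z)
        disjoint (inj₁ e₁) (inj₁ e₂) = α≢β (edge-unique e₁ e₂)
        disjoint (inj₂ e₁) (inj₂ e₂) = α≢β (edge-unique e₁ e₂)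
        disjoint (inj₁ e₁) (inj₂ e₂) = α≢β (no-rainbow gf e e₁ e₂ (≢-sym α≢γ) (≢-sym β≢γ))
        disjoint (inj₂ e₁) (inj₁ e₂) = α≢β (sym (no-rainbow gf e e₂ e₁ (≢-sym β≢γ) (≢-sym α≢γ)))

      -- Two `α`-neighbours `y`, `y′` of `x` are joined by `β`. Apart from `x`, a vertex of U_α(y,
      -- y′) cannot be an `α`-neighbour of `x`, as that would close an `α`-triangle, so it is a
      -- `β`-neighbour.
      other-degree : α ≢ γ → β ≢ γ → α ≢ β → side x ≡ b → 2 ≤ degree f α x → 3 ≤ degree f β x
      other-degree {α} {β} {x} α≢γ β≢γ α≢β Sx h with count-≥⇒pair (edge? f α x) h
      ... | y , y′ , y≢y′ , xy , xy′ = s≤s⁻¹ (begin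
        4                                    ≤⟨ spread α yy′ (≢-sym α≢β) ⟩
        codegree f α y y′                    ≤⟨ count-∪ (x ≟_) (edge? f β x) (edge? f α y ∪? edge? f α y′) cover ⟩
        count (x ≟_) + degree f β x          ≡⟨ cong (_+ degree f β x) (count-singleton x) ⟩
        1 + degree f β x                     ∎)
        where
        open ≤-Reasoning
        Sy = stays α≢γ Sx xy
        Sy′ = stays α≢γ Sx xy′

        -- No `α`-triangle contains `x`: by `dominated` the end of `xu` that sends `β` to `v` must
        -- be `u`.
        β-edge : ∀ {u v} → side u ≡ b → side v ≡ b → u ≢ v → Edge f α x u → Edge f α x v → Edge f β u v
        β-edge Su Sv u≢v xu xv = case dominated α≢γ β≢γ α≢β Sx Su Sv (distinct xv) u≢v xu of λ where
          (inj₁ e) → contradiction (edge-unique xv e) α≢β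
          (inj₂ e) → e

        yy′ = β-edge Sy Sy′ y≢y′ xy xy′

        cover : ∀ {z} → Edge f α y z ⊎ Edge f α y′ z → x ≡ z ⊎ Edge f β x z
        cover {z} e with x ≟ z
        ... | yes x≡z = inj₁ x≡z
        ... | no x≢z with edge-between f x≢z
        ...   | c , xz = inj₂ (subst (λ c → Edge f c x z) c≡β xz)
          where
          Sz = codegree-stays α≢γ Sy Sy′ e
          c≡β = third (≢-sym α≢γ) (≢-sym β≢γ) α≢β
            (λ { refl → no-joining-edge α≢γ β≢γ α≢β Sx Sz xz })
            λ { refl → α≢β (case e of λ where
              (inj₁ yz) → edge-unique yz (β-edge Sy Sz (distinct yz) xy xz)
              (inj₂ y′z) → edge-unique y′z (β-edge Sy′ Sz (distinct y′z) xy′ xz)) }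

      -- One of the summands is at least two, so the other is at least three, and then so is the
      -- first.
      unbalanced : ∀ a c → 5 ≤ a + c → a + c ≤ 5 → (2 ≤ a → 3 ≤ c) → (2 ≤ c → 3 ≤ a) → ⊥
      unbalanced 0 c 5≤ _ _ h = case h (≤-trans (s≤s (s≤s z≤n)) 5≤) of λ ()
      unbalanced 1 c 5≤ _ _ h = case h (≤-trans (s≤s (s≤s z≤n)) (s≤s⁻¹ 5≤)) of λ { (s≤s ()) }
      unbalanced (suc (suc a)) c _ ≤5 g h = impossible {6} {c = 5} (+-mono-≤ (h (≤-trans (s≤s (s≤s z≤n)) 3≤c)) 3≤c) ≤5
        where 3≤c = g (s≤s (s≤s z≤n))

      -- U_β(x, y) with `x` and `y` shows that the side has exactly six vertices, so the `α`- and
      -- `β`-degrees of `x` sum to five.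
      no-edge : α ≢ γ → β ≢ γ → α ≢ β → side x ≡ b → side y ≡ b → ¬ Edge f α x y
      no-edge {α} {β} {x} {y} α≢γ β≢γ α≢β Sx Sy e =
        unbalanced (degree f α x) (degree f β x) (s≤s⁻¹ (subst (6 ≤_) regroup degrees≥))
          (s≤s⁻¹ (subst (_≤ 6) regroup (≤-trans (star-bound S? α≢β Sx (stays α≢γ Sx) (stays β≢γ Sx)) small)))
          (other-degree α≢γ β≢γ α≢β Sx) (other-degree β≢γ α≢γ (≢-sym α≢β) Sx)
        where
        open ≤-Reasoning
        regroup : degree f α x + (degree f β x + 1) ≡ suc (degree f α x + degree f β x)
        regroup = trans (sym (+-assoc (degree f α x) (degree f β x) 1)) (+-comm _ 1)

        cover : ∀ {z} → side z ≡ b → Edge f α x z ⊎ (Edge f β x z ⊎ x ≡ z)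
        cover {z} Sz with x ≟ z
        ... | yes x≡z = inj₂ (inj₂ x≡z)
        ... | no x≢z with edge-between f x≢z
        ...   | c , xz with c ≟ α
        ...     | yes refl = inj₁ xz
        ...     | no c≢α = inj₂ (inj₁ (subst (λ c → Edge f c x z) (third (≢-sym α≢γ) (≢-sym β≢γ) α≢β
          (λ { refl → no-joining-edge α≢γ β≢γ α≢β Sx Sz xz }) c≢α) xz))

        degrees≥ : 6 ≤ degree f α x + (degree f β x + 1)
        degrees≥ = begin
          4 + 2
            ≤⟨ +-mono-≤ (spread β e α≢β) (count-pair (distinct e)) ⟩
          codegree f β x y + count (pair? x y)
            ≤⟨ count-⊎ (edge? f β x ∪? edge? f β y) (pair? x y) S? (codegree-disjoint e (≢-sym α≢β)) (codegree-stays β≢γ Sx Sy) (pair-stays Sx Sy) ⟩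
          count S?
            ≤⟨ count-∪ (edge? f α x) (edge? f β x ∪? (x ≟_)) S? cover ⟩
          degree f α x + count (edge? f β x ∪? (x ≟_))
            ≤⟨ +-monoʳ-≤ (degree f α x) (count-∪ (edge? f β x) (x ≟_) (edge? f β x ∪? (x ≟_)) id) ⟩
          degree f α x + (degree f β x + count (x ≟_))
            ≡⟨ cong (λ c → degree f α x + (degree f β x + c)) (count-singleton x) ⟩
          degree f α x + (degree f β x + 1) ∎

    small-side-singleton : side x ≡ b → side y ≡ b → x ≡ y
    small-side-singleton {x} {y} Sx Sy with others γ
    ... | i , j , i≢j , i≢γ , j≢γ = decidable-stable (x ≟ y) λ x≢y → no-colour (proj₂ (edge-between f x≢y))
      where
      no-colour : ¬ Edge f α x y
      no-colour {c} xy with c ≟ i | c ≟ j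
      ... | yes refl | _        = no-edge i≢γ j≢γ i≢j Sx Sy xy
      ... | no _     | yes refl = no-edge j≢γ i≢γ (≢-sym i≢j) Sx Sy xy
      ... | no c≢i   | no c≢j   = no-joining-edge i≢γ j≢γ i≢j Sx Sy
                                    (subst (λ c → Edge f c x y) (third i≢j i≢γ j≢γ c≢i c≢j) xy)

no-join : {f : Colouring 3 (K (3 + n))} → n ≤ 10 → Gallai f → (∀ κ → Spread 4 f κ) → ¬ Join f γ
no-join {n} {γ} {f} n≤10 gf spread J = reduce (proj₁ small-side) (proj₂ small-side)
  where
  open Join J

  n≤13 : 3 + n ≤ 13
  n≤13 = +-monoʳ-≤ 3 n≤10

  side-size : Bool → ℕ
  side-size b = count (λ y → side y Bool.≟ b)

  small-side : ∃ λ b → side-size b ≤ 6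
  small-side with side-size true ≤? 6
  ... | yes ≤6 = true , ≤6
  -- A side with at least 7 of the at most 13 vertices leaves at most 6 for the other.
  ... | no ≰6  = false , +-cancelˡ-≤ 7 _ 6
    (≤-trans (+-monoˡ-≤ (side-size false) (≰⇒> ≰6)) (≤-trans (sides-bound J) n≤13))

  reduce : ∀ b → side-size b ≤ 6 → ⊥
  reduce b small = no-spread-colouring₁₂ {f = f′} n≤10 (restrict-gallai {f = f} {g = ι} {inj = ι-injective} gf) i≢j i≢γ j≢γ
    (large-degree i≢γ) (large-degree j≢γ) spread′
    where
    i≢j = proj₁ (proj₂ (proj₂ (others γ)))
    i≢γ = proj₁ (proj₂ (proj₂ (proj₂ (others γ))))
    j≢γ = proj₂ (proj₂ (proj₂ (proj₂ (others γ))))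
    o = base b
    ι = punchIn o

    ι-injective : Injective _≡_ _≡_ ι
    ι-injective = punchIn-injective o _ _

    f′ = restrict f ι ι-injective

    joined : ∀ u → Edge f γ o (ι u)
    joined u = cross λ eq → punchInᵢ≢i o u
      (small-side-singleton n≤13 spread J gf b small (trans (sym eq) (side-base b)) (side-base b))

    -- All edges at `o` have colour `γ`, so U_α(o, ι u) consists of `α`-neighbours of `ι u` alone.
    large-degree : α ≢ γ → ∀ u → 4 ≤ degree f′ α u
    large-degree {α} α≢γ u = begin
      4
        ≤⟨ spread α (joined u) (≢-sym α≢γ) ⟩
      codegree f α o (ι u)
        ≡⟨ sum-remove {i = o} (λ z → indicator (adjacent? z)) ⟩
      indicator (adjacent? o) + count (λ z → adjacent? (ι z))
        ≤⟨ +-mono-≤ (indicator-no (adjacent? o) not-o) (count-mono (λ z → adjacent? (ι z)) (edge? f′ α u) inner) ⟩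
      degree f′ α u ∎
      where
      open ≤-Reasoning
      adjacent? = edge? f α o ∪? edge? f α (ι u)

      indicator-no : {A : Set} (A? : Dec A) → ¬ A → indicator A? ≤ 0
      indicator-no (yes a) ¬a = contradiction a ¬a
      indicator-no (no _)  _  = z≤n

      not-o : ¬ (Edge f α o o ⊎ Edge f α (ι u) o)
      not-o (inj₁ e) = distinct e refl
      not-o (inj₂ e) = α≢γ (edge-unique (edge-sym e) (joined u))

      inner : ∀ {z} → Edge f α o (ι z) ⊎ Edge f α (ι u) (ι z) → Edge f′ α u z
      inner {z} (inj₁ e) = contradiction (edge-unique e (joined z)) α≢γ
      inner     (inj₂ e) = restrict⁺ {inj = ι-injective} e

    -- Deleting `o` takes at most one vertex from U_γ.
    spread′ : Spread 3 f′ γ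
    spread′ {x} {y} e α≢γ = s≤s⁻¹ (begin
      4
        ≤⟨ spread γ (restrict⁻ {inj = ι-injective} e) α≢γ ⟩
      codegree f γ (ι x) (ι y)
        ≡⟨ sum-remove {i = o} (λ z → indicator (adjacent? z)) ⟩
      indicator (adjacent? o) + count (λ z → adjacent? (ι z))
        ≤⟨ +-mono-≤ (indicator≤1 (adjacent? o)) (count-mono (λ z → adjacent? (ι z)) (edge? f′ γ x ∪? edge? f′ γ y)
             λ { (inj₁ e) → inj₁ (restrict⁺ {inj = ι-injective} e) ; (inj₂ e) → inj₂ (restrict⁺ {inj = ι-injective} e) }) ⟩
      1 + codegree f′ γ x y ∎)
      where
      open ≤-Reasoning
      adjacent? = edge? f γ (ι x) ∪? edge? f γ (ι y)

      indicator≤1 : {A : Set} (A? : Dec A) → indicator A? ≤ 1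
      indicator≤1 (yes _) = ≤-refl
      indicator≤1 (no _)  = z≤n

no-spread-colouring₁₃ : {f : Colouring 3 (K (3 + n))} → n ≤ 10 → Gallai f → ¬ (∀ κ → Spread 4 f κ)
no-spread-colouring₁₃ {n} {f} n≤10 gf spread = excluded (proj₂ (structure (1 + n) gf))
  where
  excluded : ¬ Structure f k
  excluded (join J) = no-join n≤10 gf spread J
  excluded (quad Q) = no-quad (+-monoʳ-≤ 3 n≤10) spread Q
  excluded {k} (many P) = impossible {30} {c = 26} (many-bound P (spread k)) (*-monoʳ-≤ 2 (+-monoʳ-≤ 3 n≤10))

-- A finite search over edges and colours turns the refutation of `Spread` into an explicit spine
-- and an avoided colour.
small-codegree : {f : Colouring 3 (K (3 + n))} → n ≤ 10 → Gallai f →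
  ∃₂ λ x y → ∃₂ λ α κ → Edge f α x y × α ≢ κ × codegree f κ x y ≤ 3
small-codegree {f = f} n≤10 gf = decidable-stable
  (any? λ x → any? λ y → any? λ α → any? λ κ →
    edge? f α x y ×-dec ¬? (α ≟ κ) ×-dec codegree f κ x y ≤? 3)
  λ ¬found → no-spread-colouring₁₃ {f = f} n≤10 gf λ κ e α≢κ →
    ≰⇒> λ ≤3 → ¬found (_ , _ , _ , κ , e , α≢κ , ≤3)

-- Books

Page : Colouring 3 (K n) → Fin 3 → Fin n → Fin n → Pred (Fin n) 0ℓ
Page f κ x y z = (x ≢ z × y ≢ z) × ¬ (Edge f κ x z ⊎ Edge f κ y z)

page? : ∀ (f : Colouring 3 (K n)) κ x y → Decidable (Page f κ x y)
page? f κ x y z = (¬? (x ≟ z) ×-dec ¬? (y ≟ z)) ×-dec ¬? (edge? f κ x z ⊎-dec edge? f κ y z)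

codegree+pages : ∀ (f : Colouring 3 (K n)) κ x y → n ≤ codegree f κ x y + (2 + count (page? f κ x y))
codegree+pages {n} f κ x y = begin
  n
    ≡⟨ sum-ones n ⟨
  count everything?
    ≤⟨ count-∪ adjacent? (spine? ∪? pages?) everything? cover ⟩
  codegree f κ x y + count (spine? ∪? pages?)
    ≤⟨ +-monoʳ-≤ (codegree f κ x y) (count-∪ spine? pages? (spine? ∪? pages?) id) ⟩
  codegree f κ x y + (count spine? + count pages?)
    ≤⟨ +-monoʳ-≤ (codegree f κ x y) (+-monoˡ-≤ (count pages?) (count-∪ (x ≟_) (y ≟_) spine? id)) ⟩
  codegree f κ x y + (count (x ≟_) + count (y ≟_) + count pages?)
    ≡⟨ cong (λ c → codegree f κ x y + (c + count pages?)) (cong₂ _+_ (count-singleton x) (count-singleton y)) ⟩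
  codegree f κ x y + (2 + count pages?) ∎
  where
  open ≤-Reasoning
  adjacent? = edge? f κ x ∪? edge? f κ y
  spine? = (x ≟_) ∪? (y ≟_)
  pages? = page? f κ x y

  everything? : Decidable {A = Fin n} U
  everything? = U?

  cover : ∀ {z} → U z → (Edge f κ x z ⊎ Edge f κ y z) ⊎ ((x ≡ z ⊎ y ≡ z) ⊎ Page f κ x y z)
  cover {z} _ with adjacent? z | x ≟ z | y ≟ z
  ... | yes e | _      | _      = inj₁ e
  ... | no _  | yes eq | _      = inj₂ (inj₁ (inj₁ eq))
  ... | no _  | no _   | yes eq = inj₂ (inj₁ (inj₂ eq))
  ... | no ¬e | no x≢z | no y≢z = inj₂ (inj₂ ((x≢z , y≢z) , ¬e))

book-from-pages : {f : Colouring 3 (K n)} → Edge f α x y → ∀ {κ} → α ≢ κ → m ≤ count (page? f κ x y) →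
  ∃ λ (φ : Book m ↪ K n) → UsesAtMost 2 f φ
book-from-pages {n} {x = x} {y} {m} {f} xy {κ} α≢κ h with count-≥⇒injection (page? f κ x y) h
... | g , g-injective , page = φ , ∁ ⁅ κ ⁆ , size κ , colours
  where
  open Graph (Book m)

  vertex : Vertex → Fin n
  vertex (inj₁ 0F)      = x
  vertex (inj₁ 1F)      = y
  vertex (inj₂ (a , _)) = g a

  x≢g : ∀ a → x ≢ g a
  x≢g a = proj₁ (proj₁ (page a))

  y≢g : ∀ a → y ≢ g a
  y≢g a = proj₂ (proj₁ (page a))

  injective : Injective _≡_ _≡_ vertex
  injective {inj₁ 0F} {inj₁ 0F} _ = refl
  injective {inj₁ 0F} {inj₁ 1F} eq = contradiction eq (distinct xy)
  injective {inj₁ 1F} {inj₁ 0F} eq = contradiction (sym eq) (distinct xy)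
  injective {inj₁ 1F} {inj₁ 1F} _ = refl
  injective {inj₁ 0F} {inj₂ (a , _)} eq = contradiction eq (x≢g a)
  injective {inj₁ 1F} {inj₂ (a , _)} eq = contradiction eq (y≢g a)
  injective {inj₂ (a , _)} {inj₁ 0F} eq = contradiction (sym eq) (x≢g a)
  injective {inj₂ (a , _)} {inj₁ 1F} eq = contradiction (sym eq) (y≢g a)
  injective {inj₂ (a , 0F)} {inj₂ (b , 0F)} eq = cong (λ a → inj₂ (a , 0F)) (g-injective eq)

  φ : Book m ↪ K n
  φ = record
    { vertex = vertex
    ; injective = injective
    -- Adjacency in `K n` is inequality, so injectivity and irreflexivity suffice.
    ; edge = λ {u} {v} e eq → ~-irrefl {u} {v} (injective eq) e
    }

  -- The cardinality computes only for a concrete `κ`.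
  size : ∀ κ → ∣ ∁ ⁅ κ ⁆ ∣ ≤ 2
  size 0F = ≤-refl
  size 1F = ≤-refl
  size 2F = ≤-refl

  allowed : ∀ u v → u ~ v → ¬ Edge f κ (vertex u) (vertex v)
  allowed (inj₁ 0F) (inj₁ 0F) 0≢0 _ = 0≢0 refl
  allowed (inj₁ 0F) (inj₁ 1F) _ e = α≢κ (edge-unique xy e)
  allowed (inj₁ 1F) (inj₁ 0F) _ e = α≢κ (edge-unique xy (edge-sym e))
  allowed (inj₁ 1F) (inj₁ 1F) 1≢1 _ = 1≢1 refl
  allowed (inj₁ 0F) (inj₂ (a , _)) _ e = proj₂ (page a) (inj₁ e)
  allowed (inj₁ 1F) (inj₂ (a , _)) _ e = proj₂ (page a) (inj₂ e)
  allowed (inj₂ (a , _)) (inj₁ 0F) _ e = proj₂ (page a) (inj₁ (edge-sym e))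
  allowed (inj₂ (a , _)) (inj₁ 1F) _ e = proj₂ (page a) (inj₂ (edge-sym e))
  allowed (inj₂ (_ , 0F)) (inj₂ (_ , 0F)) (_ , 0≢0) _ = 0≢0 refl

  colours : ∀ u v (e : u ~ v) → Colouring.colour f (vertex u) (vertex v) (_↪_.edge φ {u} {v} e) ∈ ∁ ⁅ κ ⁆
  colours u v e = x∉p⇒x∈∁p λ c∈ → allowed u v e (edge (_↪_.edge φ {u} {v} e) (x∈⁅y⁆⇒x≡y κ c∈))

-- The 5 consists of the two spine vertices and the at most three vertices of U_κ(x, y).
forces-book : m ≤ 8 → Forces 3 2 (Book m) (5 + m)
forces-book {m} m≤8 f gf =
  let x , y , α , κ , xy , α≢κ , ≤3 = small-codegree {f = f} (+-monoʳ-≤ 2 m≤8) gf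
  in book-from-pages xy α≢κ
       (+-cancelˡ-≤ 5 m _ (≤-trans (codegree+pages f κ x y) (+-monoˡ-≤ _ ≤3)))

-- The lower bound

-- Colour 2 joins a set of 5 vertices to a set of 7; inside each of them colour 0 is a
-- Hamiltonian cycle and colour 1 its complement.
extremal : Fin 12 → Fin 12 → Fin 3
extremal u v = if (toℕ u <ᵇ 5) ∧ (toℕ v <ᵇ 5) then cycle 4
  else if (4 <ᵇ toℕ u) ∧ (4 <ᵇ toℕ v) then cycle 6 else 2F
  where
  cycle : ℕ → Fin 3
  -- Consecutive labels are adjacent, and the difference `last` closes the cycle.
  cycle last = if (∣ toℕ u - toℕ v ∣ ≡ᵇ 1) ∨ (∣ toℕ u - toℕ v ∣ ≡ᵇ last) then 0F else 1F

-- Stated through `extremal` directly, so that the page counts are decided by evaluation.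
ExtremalPage : Fin 3 → Fin 12 → Fin 12 → Pred (Fin 12) 0ℓ
ExtremalPage κ x y z = x ≢ z × y ≢ z × extremal x z ≢ κ × extremal y z ≢ κ

extremalPage? : ∀ κ x y → Decidable (ExtremalPage κ x y)
extremalPage? κ x y z = ¬? (x ≟ z) ×-dec ¬? (y ≟ z) ×-dec ¬? (extremal x z ≟ κ) ×-dec ¬? (extremal y z ≟ κ)

abstract
  extremal-sym : ∀ u v → extremal u v ≡ extremal v u
  extremal-sym = from-yes (all? λ u → all? λ v → extremal u v ≟ extremal v u)

  extremal-gallai : ∀ x y z → x ≢ y → x ≢ z → y ≢ z →
    extremal x y ≢ extremal x z → extremal x y ≢ extremal y z → ¬ (extremal x z ≢ extremal y z)
  extremal-gallai = from-yes (all? λ x → all? λ y → all? λ z →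
    ¬? (x ≟ y) →-dec ¬? (x ≟ z) →-dec ¬? (y ≟ z) →-dec
    ¬? (extremal x y ≟ extremal x z) →-dec ¬? (extremal x y ≟ extremal y z) →-dec
    ¬? (¬? (extremal x z ≟ extremal y z)))

  -- The value 7 is attained, for instance, by vertices at distance two on a cycle with `κ` equal to
  -- 0: they share a cycle neighbour, so U_κ has 3 elements and 12 - 2 - 3 pages remain.
  extremal-pages : ∀ κ x y → x ≢ y → extremal x y ≢ κ → count (extremalPage? κ x y) ≤ 7
  extremal-pages = from-yes (all? λ κ → all? λ x → all? λ y →
    ¬? (x ≟ y) →-dec ¬? (extremal x y ≟ κ) →-dec count (extremalPage? κ x y) ≤? 7)

missing-colour : (S : Subset 3) → ∣ S ∣ ≤ 2 → ∃ (_∉ S)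
missing-colour (outside ∷ _)                         _ = 0F , λ ()
missing-colour (inside ∷ outside ∷ _)                _ = 1F , λ { (there ()) }
missing-colour (inside ∷ inside ∷ outside ∷ [])      _ = 2F , λ { (there (there ())) }
missing-colour (inside ∷ inside ∷ inside ∷ [])       3≤2 = contradiction 3≤2 λ { (s≤s (s≤s ())) }

-- Minimality concerns every order below 13; smaller orders use the colouring induced on the first
-- `m` vertices.
no-extremal-book : ∀ {m} → m ≤ 12 → ¬ Forces 3 2 (Book 8) m
no-extremal-book {m} m≤12 forces = refute (forces g gallai)
  where
  ι : Fin m → Fin 12
  ι v = inject≤ v m≤12

  ι-injective : Injective _≡_ _≡_ ι
  ι-injective = inject≤-injective m≤12 m≤12 _ _

  g : Colouring 3 (K m)
  g = record { colour = λ u v _ → extremal (ι u) (ι v) ; symmetric = λ u v _ → extremal-sym (ι u) (ι v) }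

  gallai : Gallai g
  gallai (x , y , z , x≢y , x≢z , y≢z , p , q , r) = extremal-gallai (ι x) (ι y) (ι z)
    (x≢y ∘ ι-injective) (x≢z ∘ ι-injective) (y≢z ∘ ι-injective) p q r

  refute : ¬ (∃ λ (φ : Book 8 ↪ K m) → UsesAtMost 2 g φ)
  refute (φ , S , ∣S∣≤2 , uses) = impossible {8} {c = 7}
    (injection⇒count-≥ (extremalPage? κ p r) page page-injective λ a →
      apart (λ ()) , apart (λ ()) , avoids (inj₁ 0F) (inj₂ (a , 0F)) _ , avoids (inj₁ 1F) (inj₂ (a , 0F)) _)
    (extremal-pages κ p r (apart (λ ())) (avoids (inj₁ 0F) (inj₁ 1F) λ ()))
    where
    open Graph (Book 8)
    open _↪_ φ

    κ = proj₁ (missing-colour S ∣S∣≤2)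
    κ∉S = proj₂ (missing-colour S ∣S∣≤2)
    p = ι (vertex (inj₁ 0F))
    r = ι (vertex (inj₁ 1F))

    page : Fin 8 → Fin 12
    page a = ι (vertex (inj₂ (a , 0F)))

    page-injective : Injective _≡_ _≡_ page
    page-injective eq = case injective (ι-injective eq) of λ { refl → refl }

    apart : ∀ {u v} → u ≢ v → ι (vertex u) ≢ ι (vertex v)
    apart u≢v eq = u≢v (injective (ι-injective eq))

    avoids : ∀ u v → u ~ v → extremal (ι (vertex u)) (ι (vertex v)) ≢ κ
    avoids u v e eq = κ∉S (subst (_∈ S) eq (uses u v e))

theorem4p4 : gr[ 3 , 2 ] (Book 8) ≐ 13
theorem4p4 = forces-book ≤-refl , λ q forces → ≮⇒≥ λ q<13 → no-extremal-book (s≤s⁻¹ q<13) forces
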